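{- Every connected $6$-regular graph of odd order has a rooted $3$-odd decomposition, i.e.\ a decomposition into three closed trails, each of odd length, all sharing a common vertex.
   Context: Graphs are finite and may have multiple edges and loops (a loop contributes $2$ to the degree of its vertex). A graph is eulerian if it is connected and every vertex has even degree. A decomposition of a graph $G$ is a set $\{G_1,\dots,G_k\}$ of subgraphs of $G$ whose edge sets partition $E(G)$. A decomposition is $k$-odd if it has $k$ constituents, each of which is an eulerian subgraph (equivalently, a closed trail) with an odd number of edges. It is rooted if there is a vertex $v$ of $G$ contained in every constituent. -}

module Defs where

open import Data.Nat using (ℕ; zero; suc; _+_; _%_)
open import Data.Fin using (Fin; zero; suc; _≟_)
open import Data.Product using (_×_; _,_; proj₁; proj₂; Σ; ∃; ∃-syntax)
open import Data.Sum using (_⊎_)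
open import Relation.Binary.PropositionalEquality using (_≡_)
open import Relation.Nullary using (yes; no)

-- Finite multigraph with loops: vertices Fin order, edges Fin size,
-- each edge has two (unordered) ends; a loop has both ends equal.
record Graph : Set where
  field
    order : ℕ
    size  : ℕ
    ends  : Fin size → Fin order × Fin order
open Graph public

∑ : (k : ℕ) → (Fin k → ℕ) → ℕ
∑ zero    f = 0
∑ (suc k) f = f zero + ∑ k (λ i → f (suc i))

[_≡?_] : ∀ {n} → Fin n → Fin n → ℕ
[ x ≡? v ] with x ≟ v
... | yes _ = 1
... | no  _ = 0

endsAt : ∀ {n} → Fin n × Fin n → Fin n → ℕ
endsAt (x , y) v = [ x ≡? v ] + [ y ≡? v ]

-- degree of v in the subgraph formed by the edges e with S e,
-- S given as a 0/1 indicator so that the degree is computable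
degreeIn : (G : Graph) → (Fin (size G) → ℕ) → Fin (order G) → ℕ
degreeIn G χ v = ∑ (size G) (λ e → χ e * endsAt (ends G e) v)
  where open import Data.Nat using (_*_)

Joins : (G : Graph) → Fin (size G) → Fin (order G) → Fin (order G) → Set
Joins G e u w = (ends G e ≡ (u , w)) ⊎ (ends G e ≡ (w , u))

data Walk (G : Graph) (P : Fin (size G) → Set) : Fin (order G) → Fin (order G) → Set where
  [] : ∀ {u} → Walk G P u u
  step : ∀ {u w v} (e : Fin (size G)) → P e → Joins G e u w → Walk G P w v → Walk G P u v

Incident : (G : Graph) → (Fin (size G) → Set) → Fin (order G) → Set
Incident G P v = ∃[ e ] (P e × ∃[ w ] Joins G e v w)

Odd : ℕ → Set
Odd k = k % 2 ≡ 1

Even : ℕ → Set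
Even k = k % 2 ≡ 0

degree : (G : Graph) → Fin (order G) → ℕ
degree G = degreeIn G (λ _ → 1)

Regular : ℕ → Graph → Set
Regular d G = ∀ v → degree G v ≡ d

Connected : Graph → Set
Connected G = ∀ u v → Walk G (λ _ → ⊤) u v
  where open import Data.Unit using (⊤)

-- A k-decomposition given by assigning each edge to one of k constituents;
-- constituent i has edge set { e | c e ≡ i } and vertex set the vertices
-- incident to those edges.
InPart : (G : Graph) {k : ℕ} → (Fin (size G) → Fin k) → Fin k → Fin (size G) → Set
InPart G c i e = c e ≡ i

OddEulerianPart : (G : Graph) {k : ℕ} → (Fin (size G) → Fin k) → Fin k → Set
OddEulerianPart G c i =
  (∀ u v → Incident G (InPart G c i) u → Incident G (InPart G c i) v → Walk G (InPart G c i) u v)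
  × (∀ v → Even (degreeIn G (λ e → [ c e ≡? i ]) v))
  × Odd (∑ (size G) (λ e → [ c e ≡? i ]))

RootedOddDecomposition : ℕ → Graph → Set
RootedOddDecomposition k G =
  Σ (Fin (size G) → Fin k) λ c →
    (∀ i → OddEulerianPart G c i) × ∃[ v ] (∀ i → Incident G (InPart G c i) v)

{-# OPTIONS --safe #-}
-- Repeatedly replace two edges yx, xz by one edge yz whose sign records the parity of
-- the path, until three odd loops at one vertex remain; undoing the replacements turns
-- the loops into the three closed trails.
--
-- The replacements follow minimum cuts.  Let 2k be the size of a minimum cut (k ≤ 3 by
-- 6-regularity) and S its side with an even number of vertices.  Contract the other side
-- to a root.  Then all cuts have size at least 2k, and every 2-colouring violates at
-- least k edges (odd edges should join distinct colours, even edges equal ones):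
-- comparing the degree sums of the colour classes gives this because |S| is even and
-- k ≤ 3.  These two conditions can be kept while the vertices of S are split off one by
-- one.  Indeed, an edge a at x cannot be paired with b only if both lie in a cut of size
-- 2k or both are violated by a colouring with k violations.  Such a set contains at most
-- half of the d edges at x, cuts through a are closed under union, and a violating
-- colouring through a is unique (two of them would differ by a cut smaller than 2k), so
-- at most 2(d/2 - 1) of the d - 1 partners are excluded.  In the end S has become k odd
-- edges at the root, and what remains is again 6-regular, connected and of odd order.
module Submission where

open import Defs
import Data.Bool as 𝔹
open import Data.Bool using (Bool; true; false; not; _∧_; _∨_; _xor_; if_then_else_)
open import Data.Bool.Properties using (xor-comm; xor-same; xor-identityʳ; not-involutive; ∧-identityʳ; ∧-zeroʳ)
open import Data.Empty using (⊥; ⊥-elim)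
open import Data.Fin using (Fin; zero; suc; _≟_)
open import Data.Fin.Properties using (any?; all?)
open import Data.Fin.Subset.Properties using (anySubset?)
import Data.List as List
open import Data.List using (List; []; _∷_; _++_; map; length; filter; allFin; replicate; reverse)
open import Data.List.Membership.Propositional using (_∈_; _∉_; find)
open import Data.List.Membership.Propositional.Properties using (∈-∃++; ∈-++⁻; ∈-map⁺; ∈-filter⁺; ∈-filter⁻; ∈-allFin)
open import Data.List.Properties using (unfold-reverse; ++-assoc)
open import Data.List.Relation.Binary.Permutation.Propositional as ↭ using (_↭_; ↭-refl; ↭-sym; ↭-trans; prep; swap)
open import Data.List.Relation.Binary.Permutation.Propositional.Properties
  using (++⁺ˡ; ++⁺ʳ; ++-comm; shift; shifts; All-resp-↭; ∈-resp-↭; ↭-length; ↭-reverse) renaming (map⁺ to ↭-map⁺)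
open import Data.List.Relation.Unary.All as All using (All; []; _∷_)
open import Data.List.Relation.Unary.All.Properties
  using (¬All⇒Any¬) renaming (++⁺ to All-++⁺; ++⁻ to All-++⁻; map⁺ to All-map⁺)
open import Data.List.Relation.Unary.AllPairs using ([]; _∷_)
open import Data.List.Relation.Unary.Any using (here; there)
open import Data.List.Relation.Unary.Unique.Propositional using (Unique)
open import Data.List.Relation.Unary.Unique.Propositional.Properties
  using (allFin⁺; Unique[x∷xs]⇒x∉xs) renaming (filter⁺ to Unique-filter⁺)
open import Data.Maybe using (Maybe; just; nothing)
import Data.Nat as ℕ
open import Data.Nat using (ℕ; zero; suc; _+_; _*_; _∸_; _%_; _≤_; _<_; z≤n; s≤s; _≤?_)
open import Data.Nat.Properties hiding (_≟_)
open import Data.Nat.Tactic.RingSolver using (solve-∀)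
open import Data.Product using (_×_; _,_; proj₁; proj₂; ∃; ∃-syntax)
open import Data.Sum using (_⊎_; inj₁; inj₂)
open import Data.Unit using (⊤; tt)
open import Data.Vec using (lookup; tabulate)
open import Data.Vec.Properties using (lookup∘tabulate)
open import Function using (_∘_)
open import Relation.Binary.PropositionalEquality
  using (_≡_; _≢_; refl; sym; trans; cong; cong₂; subst; module ≡-Reasoning)
open import Relation.Nullary using (Dec; yes; no; ¬_; does)
open import Relation.Nullary.Decidable using (map′; _×-dec_; _⊎-dec_; _→-dec_; ¬?; toWitness; dec-true; dec-false)

private variable
  n : ℕ
  I J : Set

-- Sums over lists and their behaviour under permutation.

sumOver : (I → ℕ) → List I → ℕ
sumOver φ []       = 0
sumOver φ (x ∷ xs) = φ x + sumOver φ xs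

interchange : ∀ a b c d → (a + b) + (c + d) ≡ (a + c) + (b + d)
interchange = solve-∀

sumOver-↭ : (φ : I → ℕ) {xs ys : List I} → xs ↭ ys → sumOver φ xs ≡ sumOver φ ys
sumOver-↭ φ ↭.refl       = refl
sumOver-↭ φ (prep x p)   = cong (φ x +_) (sumOver-↭ φ p)
sumOver-↭ φ (swap {xs} {ys} x y p) = begin
  φ x + (φ y + sumOver φ xs) ≡⟨ sym (+-assoc (φ x) (φ y) _) ⟩
  (φ x + φ y) + sumOver φ xs ≡⟨ cong₂ _+_ (+-comm (φ x) (φ y)) (sumOver-↭ φ p) ⟩
  (φ y + φ x) + sumOver φ ys ≡⟨ +-assoc (φ y) (φ x) _ ⟩
  φ y + (φ x + sumOver φ ys) ∎
  where open ≡-Reasoning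
sumOver-↭ φ (↭.trans p q) = trans (sumOver-↭ φ p) (sumOver-↭ φ q)

sumOver-++ : (φ : I → ℕ) (xs ys : List I) → sumOver φ (xs ++ ys) ≡ sumOver φ xs + sumOver φ ys
sumOver-++ φ []       ys = refl
sumOver-++ φ (x ∷ xs) ys = trans (cong (φ x +_) (sumOver-++ φ xs ys)) (sym (+-assoc (φ x) _ _))

sumOver-map : (φ : J → ℕ) (g : I → J) (xs : List I) → sumOver φ (map g xs) ≡ sumOver (λ x → φ (g x)) xs
sumOver-map φ g []       = refl
sumOver-map φ g (x ∷ xs) = cong (φ (g x) +_) (sumOver-map φ g xs)

sumOver-cong : {φ ψ : I → ℕ} {xs : List I} → All (λ x → φ x ≡ ψ x) xs → sumOver φ xs ≡ sumOver ψ xs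
sumOver-cong []       = refl
sumOver-cong (p ∷ ps) = cong₂ _+_ p (sumOver-cong ps)

sumOver-mono : {φ ψ : I → ℕ} {xs : List I} → All (λ x → φ x ≤ ψ x) xs → sumOver φ xs ≤ sumOver ψ xs
sumOver-mono []       = z≤n
sumOver-mono (p ∷ ps) = +-mono-≤ p (sumOver-mono ps)

sumOver-+ : (φ ψ : I → ℕ) (xs : List I) → sumOver (λ x → φ x + ψ x) xs ≡ sumOver φ xs + sumOver ψ xs
sumOver-+ φ ψ []       = refl
sumOver-+ φ ψ (x ∷ xs) = trans (cong (φ x + ψ x +_) (sumOver-+ φ ψ xs)) (interchange (φ x) (ψ x) _ _)

sumOver-const1 : (xs : List I) → sumOver (λ _ → 1) xs ≡ length xs
sumOver-const1 []       = refl
sumOver-const1 (x ∷ xs) = cong suc (sumOver-const1 xs)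

-- Signed edges, cuts and 2-colourings

bit : Bool → ℕ
bit true  = 1
bit false = 0

-- Makes statements about finitely many Booleans decidable, so that `toWitness` proves them by
-- running through all cases.
∀𝔹? : {P : Bool → Set} → (∀ b → Dec (P b)) → Dec (∀ b → P b)
∀𝔹? d = map′ (λ { (p , q) true → p ; (p , q) false → q }) (λ h → h true , h false) (d true ×-dec d false)

-- An edge with a sign; true stands for odd length.
Edge : ℕ → Set
Edge n = Fin n × Fin n × Bool

Label : ℕ → Set
Label n = Fin n → Bool

-- For t = false these are the edges of the cut given by f, for t = true the
-- edges that violate f read as a 2-colouring (odd edges join distinct colours).
crosses : Bool → Label n → Edge n → Bool
crosses t f (u , w , s) = (f u xor f w) xor (t ∧ s)

N : Bool → Label n → List (Edge n) → ℕ
N t f = sumOver (λ e → bit (crosses t f e))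

W : (Fin n → ℕ) → List (Edge n) → ℕ
W o = sumOver (λ (u , w , _) → o u + o w)

Odd-sign : Edge n → Set
Odd-sign (_ , _ , s) = s ≡ true

Avoids : Fin n → Edge n → Set
Avoids x (u , w , _) = u ≢ x × w ≢ x

infix 3 _⇝_

-- An edge stands for a trail and its sign for the parity of the length; lengths add up under
-- `join`, hence the `xor`.
data _⇝_ {n} : List (Edge n) → List (Edge n) → Set where
  perm    : ∀ {E E′} → E ↭ E′ → E ⇝ E′
  flip    : ∀ {u w s E} → (u , w , s) ∷ E ⇝ (w , u , s) ∷ E
  join    : ∀ {y x z s t E} → (y , x , s) ∷ (x , z , t) ∷ E ⇝ (y , z , s xor t) ∷ E
  ⇝-trans : ∀ {E E′ E″} → E ⇝ E′ → E′ ⇝ E″ → E ⇝ E″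

⇝-++ : ∀ {E E′ : List (Edge n)} R → E ⇝ E′ → E ++ R ⇝ E′ ++ R
⇝-++ R (perm p)      = perm (++⁺ʳ R p)
⇝-++ R flip          = flip
⇝-++ R join          = join
⇝-++ R (⇝-trans p q) = ⇝-trans (⇝-++ R p) (⇝-++ R q)

crosses-flip : ∀ t (f : Label n) u w s → crosses t f (u , w , s) ≡ crosses t f (w , u , s)
crosses-flip t f u w s = cong (_xor (t ∧ s)) (xor-comm (f u) (f w))

crosses-cong : ∀ t (f g : Label n) u w s → f u ≡ g u → f w ≡ g w →
               crosses t f (u , w , s) ≡ crosses t g (u , w , s)
crosses-cong t f g u w s p q = cong₂ (λ a b → (a xor b) xor (t ∧ s)) p q

crosses-not : ∀ t (f : Label n) e → crosses t (λ y → not (f y)) e ≡ crosses t f e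
crosses-not t f (u , w , s) = lemma (f u) (f w)
  where
  lemma : ∀ a b → (not a xor not b) xor (t ∧ s) ≡ (a xor b) xor (t ∧ s)
  lemma true  true  = refl
  lemma true  false = refl
  lemma false true  = refl
  lemma false false = refl

N-cong : ∀ t {f g : Label n} E → (∀ y → f y ≡ g y) → N t f E ≡ N t g E
N-cong t {f} {g} E h = sumOver-cong (All.universal (λ (u , w , s) → cong bit (crosses-cong t f g u w s (h u) (h w))) E)

N-not : ∀ t (f : Label n) E → N t (λ y → not (f y)) E ≡ N t f E
N-not t f E = sumOver-cong (All.universal (λ e → cong bit (crosses-not t f e)) E)

W-cong : {o p : Fin n → ℕ} (E : List (Edge n)) → (∀ y → o y ≡ p y) → W o E ≡ W p E
W-cong E h = sumOver-cong (All.universal (λ (u , w , _) → cong₂ _+_ (h u) (h w)) E)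

-- Crossing is a sum modulo 2 of the labels of both ends and, for `t = true`, the sign. Adding the
-- two edges cancels the label of x.
crosses-join : ∀ t (f : Label n) x y z s s′ →
  crosses t f (y , z , s xor s′) ≡ crosses t f (x , y , s) xor crosses t f (x , z , s′)
crosses-join t f x y z s s′ = toWitness
  {a? = ∀𝔹? λ t → ∀𝔹? λ a → ∀𝔹? λ b → ∀𝔹? λ c → ∀𝔹? λ s → ∀𝔹? λ s′ →
        ((b xor c) xor (t ∧ (s xor s′))) 𝔹.≟ (((a xor b) xor (t ∧ s)) xor ((a xor c) xor (t ∧ s′)))}
  tt t (f x) (f y) (f z) s s′

N-join : ∀ t (f : Label n) x y z s s′ E →
  N t f ((x , y , s) ∷ (x , z , s′) ∷ E) ≡ N t f ((y , z , s xor s′) ∷ E)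
  ⊎ crosses t f (x , y , s) ≡ true × crosses t f (x , z , s′) ≡ true
    × N t f ((x , y , s) ∷ (x , z , s′) ∷ E) ≡ suc (suc (N t f ((y , z , s xor s′) ∷ E)))
N-join t f x y z s s′ E
  with crosses t f (x , y , s) | crosses t f (x , z , s′) | crosses t f (y , z , s xor s′) | crosses-join t f x y z s s′
... | true  | true  | _ | refl = inj₂ (refl , refl , refl)
... | true  | false | _ | refl = inj₁ refl
... | false | true  | _ | refl = inj₁ refl
... | false | false | _ | refl = inj₁ refl

infix 4 _≼_

-- Inequality together with equal parity. A merge lowers `N` by 0 or 2, so a value strictly above
-- its threshold survives any merge.
data _≼_ (a : ℕ) : ℕ → Set where
  here : a ≼ a
  up   : ∀ {b} → a ≼ b → a ≼ suc (suc b)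

≼⇒≤ : ∀ {a b} → a ≼ b → a ≤ b
≼⇒≤ here   = ≤-refl
≼⇒≤ (up p) = m≤n⇒m≤1+n (m≤n⇒m≤1+n (≼⇒≤ p))

≼-double : ∀ a h → a ≼ h + h + a
≼-double a zero    = here
≼-double a (suc h) = subst (a ≼_) (cong (λ m → suc (m + a)) (sym (+-suc h h))) (up (≼-double a h))

≼-intro : ∀ {a b} h → b ≡ h + h + a → a ≼ b
≼-intro h refl = ≼-double _ h

-- What remains of an edge once one end x is fixed: `(x , h)` is an edge because pairs nest to the
-- right.
Half : ℕ → Set
Half n = Fin n × Bool

-- The search runs over Boolean vectors. A label agrees with its vector only pointwise, so the
-- property must respect pointwise equality.
anyLabel? : {P : Label n → Set} → (∀ {f g} → (∀ y → f y ≡ g y) → P f → P g) →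
            (∀ f → Dec (P f)) → Dec (∃ P)
anyLabel? resp P? = map′
  (λ (v , p) → lookup v , p)
  (λ (f , p) → tabulate f , resp (λ y → sym (lookup∘tabulate f y)) p)
  (anySubset? (λ v → P? (lookup v)))

toggle : Fin n → Label n → Label n
toggle x f y = f y xor does (y ≟ x)

toggle-≢ : ∀ {x : Fin n} f {y} → y ≢ x → toggle x f y ≡ f y
toggle-≢ {x = x} f {y} y≢x rewrite dec-false (y ≟ x) y≢x = xor-identityʳ (f y)

toggle-≡ : ∀ (x : Fin n) f → toggle x f x ≡ not (f x)
toggle-≡ x f rewrite dec-true (x ≟ x) refl = xor-comm (f x) true

Separates : (Fin n → Set) → Label n → Set
Separates Q f = (∃[ y ] (Q y × f y ≡ true)) × (∃[ z ] (Q z × f z ≡ false))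

separates-not : {Q : Fin n → Set} {f : Label n} → Separates Q f → Separates Q (λ y → not (f y))
separates-not ((y , q , p) , (z , q′ , p′)) = (z , q′ , cong not p′) , (y , q , cong not p)

-- An edge that violates neither colouring changes the colour in both exactly when it is odd, so it
-- does not cut their sum.
bit-xor-cut : ∀ a b c d s → bit (((a xor c) xor (b xor d)) xor false)
                            ≤ bit ((a xor b) xor s) + bit ((c xor d) xor s)
bit-xor-cut = toWitness
  {a? = ∀𝔹? λ a → ∀𝔹? λ b → ∀𝔹? λ c → ∀𝔹? λ d → ∀𝔹? λ s →
        bit (((a xor c) xor (b xor d)) xor false) ≤? bit ((a xor b) xor s) + bit ((c xor d) xor s)} tt

-- Submodularity of the cut function, which holds edge by edge.
N-submodular : ∀ (f g : Label n) E →
  N false (λ y → f y ∨ g y) E + N false (λ y → f y ∧ g y) E ≤ N false f E + N false g E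
N-submodular f g E = begin
  N false (λ y → f y ∨ g y) E + N false (λ y → f y ∧ g y) E
    ≡⟨ sym (sumOver-+ _ _ E) ⟩
  sumOver (λ e → bit (crosses false (λ y → f y ∨ g y) e) + bit (crosses false (λ y → f y ∧ g y) e)) E
    ≤⟨ sumOver-mono (All.universal (λ (u , w , _) → edge (f u) (f w) (g u) (g w)) E) ⟩
  sumOver (λ e → bit (crosses false f e) + bit (crosses false g e)) E
    ≡⟨ sumOver-+ _ _ E ⟩
  N false f E + N false g E ∎
  where
  open ≤-Reasoning
  edge : ∀ a b c d → bit (((a ∨ c) xor (b ∨ d)) xor false) + bit (((a ∧ c) xor (b ∧ d)) xor false)
                     ≤ bit ((a xor b) xor false) + bit ((c xor d) xor false)
  edge = toWitness
    {a? = ∀𝔹? λ a → ∀𝔹? λ b → ∀𝔹? λ c → ∀𝔹? λ d →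
          bit (((a ∨ c) xor (b ∨ d)) xor false) + bit (((a ∧ c) xor (b ∧ d)) xor false)
          ≤? bit ((a xor b) xor false) + bit ((c xor d) xor false)} tt

_⊕_ : Label n → Label n → Label n
(f ⊕ g) y = f y xor g y

N-⊕ : ∀ (f g : Label n) E → N false (f ⊕ g) E ≤ N true f E + N true g E
N-⊕ f g E = ≤-trans
  (sumOver-mono (All.universal (λ (u , w , s) → bit-xor-cut (f u) (f w) (g u) (g w) s) E))
  (≤-reflexive (sumOver-+ _ _ E))

-- The invariant of the reduction, tight labels and blocked pairs.

module Reduction {n} (k : ℕ) (root : Fin n) where

  threshold : Bool → ℕ
  threshold false = k + k
  threshold true  = k

  -- The vertices outside xs count as contracted to the root.
  Allowed : List (Fin n) → Label n → Set
  Allowed xs f = ∀ y → y ∉ xs → f y ≡ f root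

  -- The invariant kept by all replacements. `Q` tells which vertices a cut has to separate: all
  -- vertices between two splittings, all but x while the star of x is being used up, since the cut
  -- around x then shrinks to nothing.
  Good : (Fin n → Set) → List (Fin n) → List (Edge n) → Set
  Good Q xs E = ∀ t f → Allowed xs f → (t ≡ false → Separates Q f) → threshold t ≼ N t f E

  record Tight (Q : Fin n → Set) (xs : List (Fin n)) (E : List (Edge n)) (t : Bool) (f : Label n) : Set where
    constructor tight
    field
      allowed   : Allowed xs f
      separates : t ≡ false → Separates Q f
      value     : N t f E ≡ threshold t
  open Tight public

  Good-↭ : ∀ {Q xs E E′} → E ↭ E′ → Good Q xs E → Good Q xs E′
  Good-↭ p good t f al sep = subst (threshold t ≼_) (sumOver-↭ _ p) (good t f al sep)

  -- If both merged edges cross a label, its count drops by 2; by parity this passes below the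
  -- threshold only from equality, that is, for a tight label.
  Good-join : ∀ {Q xs x} (a b : Half n) {E} →
    Good Q xs ((x , a) ∷ (x , b) ∷ E) →
    (∀ t f → Tight Q xs ((x , a) ∷ (x , b) ∷ E) t f →
       crosses t f (x , a) ≡ true → crosses t f (x , b) ≡ true → ⊥) →
    Good Q xs ((proj₁ a , proj₁ b , proj₂ a xor proj₂ b) ∷ E)
  Good-join {x = x} (y , s) (z , s′) {E} good free t f al sep
    with N-join t f x y z s s′ E | good t f al sep
  ... | inj₁ eq            | g = subst (threshold t ≼_) eq g
  ... | inj₂ (p , q , eq)  | g = drop g eq (λ e → free t f (tight al sep e) p q)
    where
    drop : ∀ {a b c} → a ≼ b → b ≡ suc (suc c) → (b ≡ a → ⊥) → a ≼ c
    drop here   _    h = ⊥-elim (h refl)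
    drop (up p) refl _ = p

  allowed-op : ∀ {xs f g} (_∙_ : Bool → Bool → Bool) → Allowed xs f → Allowed xs g → Allowed xs (λ y → f y ∙ g y)
  allowed-op _∙_ p q y y∉ = cong₂ _∙_ (p y y∉) (q y y∉)

  tight-not : ∀ {Q xs E t f} → Tight Q xs E t f → Tight Q xs E t (λ y → not (f y))
  tight-not {E = E} {t} {f} (tight al sep val) =
    tight (λ y y∉ → cong not (al y y∉)) (λ e → separates-not (sep e)) (trans (N-not t f E) val)

  -- Complementing a label changes no crossing, so x may be put on the false side. This makes labels
  -- comparable.
  normalise : ∀ {Q xs E t f} x → Tight Q xs E t f →
    ∃[ g ] (Tight Q xs E t g × g x ≡ false × (∀ e → crosses t g e ≡ crosses t f e))
  normalise {t = t} {f} x tf with f x in eq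
  ... | false = f , tf , eq , λ _ → refl
  ... | true  = (λ y → not (f y)) , tight-not tf , cong not eq , crosses-not t f

  Tight-resp : ∀ {Q xs E t f g} → (∀ y → f y ≡ g y) → Tight Q xs E t f → Tight Q xs E t g
  Tight-resp {E = E} {t} h (tight al sep val) = tight
    (λ y y∉ → trans (sym (h y)) (trans (al y y∉) (h root)))
    (λ e → let ((y , q , p) , (z , q′ , p′)) = sep e in (y , q , trans (sym (h y)) p) , (z , q′ , trans (sym (h z)) p′))
    (trans (sym (N-cong t E h)) val)

  Tight? : ∀ {Q xs E} → (∀ y → Dec (Q y)) → ∀ t f → Dec (Tight Q xs E t f)
  Tight? {xs = xs} {E} Q? t f = map′ (λ (a , s , v) → tight a s v) (λ (tight a s v) → a , s , v)
    (all? (λ y → ¬? (y ∈? xs) →-dec (f y 𝔹.≟ f root))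
     ×-dec ((t 𝔹.≟ false) →-dec (any? (λ y → Q? y ×-dec (f y 𝔹.≟ true)) ×-dec any? (λ z → Q? z ×-dec (f z 𝔹.≟ false))))
     ×-dec (N t f E ℕ.≟ threshold t))
    where open import Data.List.Membership.DecPropositional (_≟_ {n}) using (_∈?_)

  -- Merging e and e′ lowers N by 2 for every label that both cross, which is fatal exactly for tight labels.
  Blocked : (Fin n → Set) → List (Fin n) → List (Edge n) → Bool → Edge n → Edge n → Set
  Blocked Q xs E t e e′ = ∃[ f ] (Tight Q xs E t f × crosses t f e ≡ true × crosses t f e′ ≡ true)

  -- Decidability turns the counting result that not all partners are blocked into an actual free
  -- partner.
  Blocked? : ∀ {Q xs E} → (∀ y → Dec (Q y)) → ∀ t e e′ → Dec (Blocked Q xs E t e e′)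
  Blocked? {Q} {xs} {E} Q? t e e′ = anyLabel?
    (λ {f} {g} h (tf , c , c′) → Tight-resp h tf , trans (sym (cc h e)) c , trans (sym (cc h e′)) c′)
    (λ f → Tight? Q? t f ×-dec (crosses t f e 𝔹.≟ true) ×-dec (crosses t f e′ 𝔹.≟ true))
    where
    cc : ∀ {f g} → (∀ y → f y ≡ g y) → ∀ e → crosses t f e ≡ crosses t g e
    cc {f} {g} h (u , w , s) = crosses-cong t f g u w s (h u) (h w)

-- Splitting off a vertex

stars : Fin n → List (Half n) → List (Edge n)
stars x = map (x ,_)

count : Bool → Label n → Fin n → List (Half n) → ℕ
count t f x = sumOver (λ h → bit (crosses t f (x , h)))

N-stars : ∀ t (f : Label n) x Y R → N t f (stars x Y ++ R) ≡ count t f x Y + N t f R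
N-stars t f x Y R = trans (sumOver-++ _ (stars x Y) R) (cong (_+ N t f R) (sumOver-map _ (x ,_) Y))

N-avoids : ∀ t {f g : Label n} {x R} → (∀ {y} → y ≢ x → f y ≡ g y) → All (Avoids x) R → N t f R ≡ N t g R
N-avoids t {f} {g} h av = sumOver-cong
  (All.map (λ { {u , w , s} (p , q) → cong bit (crosses-cong t f g u w s (h p) (h q)) }) av)

-- Each edge of the star has exactly one end toggled, so it crosses exactly one of the two labels.
count-toggle : ∀ t (f : Label n) {x Y} → All (λ h → proj₁ h ≢ x) Y →
               count t (toggle x f) x Y + count t f x Y ≡ length Y
count-toggle t f []                          = refl
count-toggle t f {x} {(y , s) ∷ Y} (y≢x ∷ p) =
  trans (interchange (bit (crosses t (toggle x f) (x , y , s))) _ _ _)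
        (cong₂ _+_ one (count-toggle t f p))
  where
  lemma : ∀ a b c → bit ((not a xor b) xor c) + bit ((a xor b) xor c) ≡ 1
  lemma = toWitness {a? = ∀𝔹? λ a → ∀𝔹? λ b → ∀𝔹? λ c →
    (bit ((not a xor b) xor c) + bit ((a xor b) xor c)) ℕ.≟ 1} tt
  one : bit (crosses t (toggle x f) (x , y , s)) + bit (crosses t f (x , y , s)) ≡ 1
  one rewrite toggle-≡ x f | toggle-≢ {x = x} f y≢x = lemma (f x) (f y) (t ∧ s)

∈⇒↭ : ∀ {A : Set} {x : A} {xs} → x ∈ xs → ∃[ ys ] (xs ↭ x ∷ ys)
∈⇒↭ {x = x} p with ∈-∃++ p
... | as , bs , refl = as ++ bs , shift x as bs

true≢false : ∀ {b} → b ≡ true → b ≡ false → ⊥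
true≢false refl ()

≢true⇒≡false : ∀ {b} → ¬ b ≡ true → b ≡ false
≢true⇒≡false {true}  h = ⊥-elim (h refl)
≢true⇒≡false {false} h = refl

∨-trueˡ : ∀ {a} b → a ≡ true → a ∨ b ≡ true
∨-trueˡ b refl = refl

∨-trueʳ : ∀ a {b} → b ≡ true → a ∨ b ≡ true
∨-trueʳ true  refl = refl
∨-trueʳ false refl = refl

∨-falseˡ : ∀ a {b} → a ∨ b ≡ false → a ≡ false
∨-falseˡ false _ = refl

-- Two tight colourings violated by a common edge.

module Uncross {n} (k : ℕ) (root : Fin n) where

  open Reduction k root

  -- The common edge counts once in each of the two values k but does not lie in the cut `f ⊕ g`,
  -- which therefore has at most 2k - 2 edges.
  tight-⊕ : ∀ {xs Q E e} {f g : Label n} → e ∈ E →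
    Good Q xs E → Tight Q xs E true f → Tight Q xs E true g →
    crosses true f e ≡ true → crosses true g e ≡ true → ¬ Separates Q (f ⊕ g)
  tight-⊕ {xs} {Q} {E} {e} {f} {g} e∈E good tf tg cf cg sep with ∈⇒↭ e∈E
  ... | E′ , p = <-irrefl refl (begin-strict
    k + k                              ≤⟨ ≼⇒≤ (good false (f ⊕ g) (allowed-op _xor_ (allowed tf) (allowed tg)) (λ _ → sep)) ⟩
    N false (f ⊕ g) E                  ≡⟨ sumOver-↭ _ p ⟩
    bit (crosses false (f ⊕ g) e) + N false (f ⊕ g) E′ ≡⟨ cong (λ b → bit b + N false (f ⊕ g) E′) (uncut e cf cg) ⟩
    N false (f ⊕ g) E′                 ≤⟨ N-⊕ f g E′ ⟩
    N true f E′ + N true g E′          <⟨ +-mono-< (n<1+n _) (n<1+n _) ⟩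
    suc (N true f E′) + suc (N true g E′) ≡⟨ sym (cong₂ _+_ (count1 f cf tf) (count1 g cg tg)) ⟩
    k + k                              ∎)
    where
    open ≤-Reasoning
    uncut : ∀ e → crosses true f e ≡ true → crosses true g e ≡ true → crosses false (f ⊕ g) e ≡ false
    uncut (u , w , s) = lemma (f u) (f w) (g u) (g w) s
      where
      lemma : ∀ a b c d s → (a xor b) xor s ≡ true → (c xor d) xor s ≡ true → ((a xor c) xor (b xor d)) xor false ≡ false
      lemma = toWitness {a? = ∀𝔹? λ a → ∀𝔹? λ b → ∀𝔹? λ c → ∀𝔹? λ d → ∀𝔹? λ s →
        (((a xor b) xor s) 𝔹.≟ true) →-dec ((((c xor d) xor s) 𝔹.≟ true) →-dec ((((a xor c) xor (b xor d)) xor false) 𝔹.≟ false))} tt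
    count1 : ∀ h → crosses true h e ≡ true → Tight Q xs E true h → k ≡ suc (N true h E′)
    count1 h c th = trans (sym (value th)) (trans (sumOver-↭ _ p) (cong (λ b → bit b + N true h E′) c))

-- Finding a partner for an edge at a vertex without loops.

module Star {n} (k : ℕ) (root : Fin n) (x : Fin n) (xs : List (Fin n)) (a : Half n) (Y : List (Half n)) (R : List (Edge n))
  (root≢x : root ≢ x) (Y≢x : All (λ h → proj₁ h ≢ x) (a ∷ Y)) (R≢x : All (Avoids x) R)
  (good : Reduction.Good k root (_≢ x) (x ∷ xs) (stars x (a ∷ Y) ++ R))
  where

  open Reduction k root
  open Uncross k root

  E : List (Edge n)
  E = stars x (a ∷ Y) ++ R

  T : Bool → Label n → Set
  T = Tight (_≢ x) (x ∷ xs) E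

  -- Moving x to the other side exchanges the crossed and the uncrossed edges of its star and leaves
  -- `R` alone. A tight label has the least possible value, so this cannot lower the count.
  half-bound : ∀ {t f} → T t f → count t f x (a ∷ Y) + count t f x (a ∷ Y) ≤ suc (length Y)
  half-bound {t} {f} tf = begin
    c + c  ≤⟨ +-monoˡ-≤ c (+-cancelʳ-≤ (N t f R) c c′ (begin
      c + N t f R   ≡⟨ sym (N-stars t f x (a ∷ Y) R) ⟩
      N t f E       ≡⟨ value tf ⟩
      threshold t   ≤⟨ ≼⇒≤ (good t (toggle x f) allowed′ separates′) ⟩
      N t (toggle x f) E ≡⟨ N-stars t (toggle x f) x (a ∷ Y) R ⟩
      c′ + N t (toggle x f) R ≡⟨ cong (c′ +_) (N-avoids t (toggle-≢ f) R≢x) ⟩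
      c′ + N t f R  ∎)) ⟩
    c′ + c ≡⟨ count-toggle t f Y≢x ⟩
    suc (length Y) ∎
    where
    open ≤-Reasoning
    c  = count t f x (a ∷ Y)
    c′ = count t (toggle x f) x (a ∷ Y)
    allowed′ : Allowed (x ∷ xs) (toggle x f)
    allowed′ y y∉ = trans (toggle-≢ f (λ { refl → y∉ (here refl) }))
                          (trans (allowed tf y y∉) (sym (toggle-≢ f root≢x)))
    -- Only vertices other than x have to be separated, and `toggle` leaves their labels alone.
    separates′ : t ≡ false → Separates (_≢ x) (toggle x f)
    separates′ e = let ((y , q , p) , (z , q′ , p′)) = separates tf e in
      (y , q , trans (toggle-≢ f q) p) , (z , q′ , trans (toggle-≢ f q′) p′)

  -- A normalised obstruction to merging `(x , a)`: the edges at x that it also crosses are the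
  -- partners it excludes.
  Core : Bool → Set
  Core t = ∃[ f ] (T t f × f x ≡ false × crosses t f (x , a) ≡ true)

  label : ∀ {t} → Core t → Label n
  label = proj₁

  cut-at : ∀ f → f x ≡ false → ∀ y s → crosses false f (x , y , s) ≡ f y
  cut-at f fx y s rewrite fx = xor-identityʳ (f y)

  -- Both cuts have the end of a on their true side. If some vertex other than x lies outside the
  -- union, then union and intersection are both separating, and submodularity forces the value 2k
  -- on the union.
  merge-cut : ∀ f g → T false f → T false g → f x ≡ false → g x ≡ false →
    f (proj₁ a) ≡ true → g (proj₁ a) ≡ true → T false (λ y → f y ∨ g y)
  merge-cut f g tf tg fx gx fa ga with any? (λ z → ¬? (z ≟ x) ×-dec ((f z ∨ g z) 𝔹.≟ false))
  ... | yes (z , z≢x , hz) = tight al∨ (λ _ → sep∨)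
        (≤-antisym (+-cancelʳ-≤ (k + k) _ _ (begin
            N false h E + (k + k)         ≤⟨ +-monoʳ-≤ (N false h E) (≼⇒≤ (good false i (allowed-op _∧_ (allowed tf) (allowed tg)) (λ _ → sep∧))) ⟩
            N false h E + N false i E     ≤⟨ N-submodular f g E ⟩
            N false f E + N false g E     ≡⟨ cong₂ _+_ (value tf) (value tg) ⟩
            (k + k) + (k + k)             ∎))
          (≼⇒≤ (good false h al∨ (λ _ → sep∨))))
    where
    open ≤-Reasoning
    h = λ y → f y ∨ g y
    i = λ y → f y ∧ g y
    a≢x = All.head Y≢x
    al∨ = allowed-op _∨_ (allowed tf) (allowed tg)
    sep∨ : Separates (_≢ x) h
    sep∨ = (proj₁ a , a≢x , ∨-trueˡ _ fa) , (z , z≢x , hz)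
    sep∧ : Separates (_≢ x) i
    sep∧ = (proj₁ a , a≢x , cong₂ _∧_ fa ga) , (z , z≢x , cong (_∧ g z) (∨-falseˡ (f z) hz))
  -- Otherwise every edge at x lies in one of the two cuts and a lies in both, although each cut
  -- contains at most half of the star.
  ... | no all-true = ⊥-elim (<-irrefl refl (begin-strict
    L + L                              <⟨ +-mono-< too-many too-many ⟩
    (cf + cg) + (cf + cg)              ≡⟨ interchange cf cg cf cg ⟩
    (cf + cf) + (cg + cg)              ≤⟨ +-mono-≤ (half-bound tf) (half-bound tg) ⟩
    L + L                              ∎))
    where
    open ≤-Reasoning
    L  = suc (length Y)
    φ ψ : Half n → ℕ
    φ b = bit (crosses false f (x , b))
    ψ b = bit (crosses false g (x , b))
    cf = count false f x (a ∷ Y)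
    cg = count false g x (a ∷ Y)
    one : ∀ {b : Half n} → proj₁ b ≢ x → 1 ≤ bit (crosses false f (x , b)) + bit (crosses false g (x , b))
    one {y , s} y≢x rewrite fx | gx with f y in fy | g y in gy
    ... | true  | _     = s≤s z≤n
    ... | false | true  = s≤s z≤n
    ... | false | false = ⊥-elim (all-true (y , y≢x , cong₂ _∨_ fy gy))
    two : bit (crosses false f (x , a)) + bit (crosses false g (x , a)) ≡ 2
    two rewrite fx | gx | fa | ga = refl
    too-many : L < cf + cg
    too-many = begin-strict
      suc (length Y)       <⟨ n<1+n _ ⟩
      2 + length Y         ≡⟨ cong (2 +_) (sym (sumOver-const1 Y)) ⟩
      2 + sumOver (λ _ → 1) Y ≤⟨ +-mono-≤ (≤-reflexive (sym two)) (sumOver-mono (All.map (λ {b} → one {b}) (All.tail Y≢x))) ⟩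
      sumOver (λ b → φ b + ψ b) (a ∷ Y) ≡⟨ sumOver-+ φ ψ (a ∷ Y) ⟩
      cf + cg              ∎

  -- For cuts the union serves; two tight colourings violated by a coincide, so for colourings
  -- either of them serves.
  merge : ∀ t (F G : Core t) → ∃[ H ] (∀ b → crosses t (label {t} F) (x , b) ≡ true ⊎ crosses t (label {t} G) (x , b) ≡ true →
                                         crosses t (label {t} H) (x , b) ≡ true)
  merge false (f , tf , fx , fa) (g , tg , gx , ga) =
    (h , merge-cut f g tf tg fx gx (at f fx a fa) (at g gx a ga) , hx , trans (cut-at h hx _ (proj₂ a)) (∨-trueˡ _ (at f fx a fa))) ,
    λ b → λ { (inj₁ p) → trans (cut-at h hx _ (proj₂ b)) (∨-trueˡ _ (at f fx b p))
            ; (inj₂ p) → trans (cut-at h hx _ (proj₂ b)) (∨-trueʳ (f (proj₁ b)) (at g gx b p)) }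
    where
    h = λ y → f y ∨ g y
    hx : f x ∨ g x ≡ false
    hx = cong₂ _∨_ fx gx
    at : ∀ f → f x ≡ false → ∀ b → crosses false f (x , b) ≡ true → f (proj₁ b) ≡ true
    at f fx (y , s) p = trans (sym (cut-at f fx y s)) p
  merge true (f , tf , fx , fa) (g , tg , gx , ga) =
    (f , tf , fx , fa) , λ { b (inj₁ p) → p ; (y , s) (inj₂ p) → trans (crosses-cong true f g x y s (same x) (same y)) p }
    where
    -- Both labels are false at x and are violated by a, so they also agree at its far end.
    a-same : (f ⊕ g) (proj₁ a) ≡ false
    a-same = lemma (f x) (g x) (f (proj₁ a)) (g (proj₁ a)) (proj₂ a) fx gx fa ga
      where
      lemma : ∀ a b c d s → a ≡ false → b ≡ false → (a xor c) xor s ≡ true → (b xor d) xor s ≡ true → c xor d ≡ false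
      lemma false false c d s _ _ p q = xor-eq c d s (trans p (sym q))
        where
        xor-eq : ∀ c d s → c xor s ≡ d xor s → c xor d ≡ false
        xor-eq true  true  _     _ = refl
        xor-eq false false _     _ = refl
        xor-eq true  false true  ()
        xor-eq true  false false ()
        xor-eq false true  true  ()
        xor-eq false true  false ()
    same : ∀ y → f y ≡ g y
    same y with f y in fy | g y in gy
    ... | true  | true  = refl
    ... | false | false = refl
    -- At a vertex of disagreement `f ⊕ g` is true, at the far end of a it is false, and neither of
    -- these is x; `tight-⊕` excludes such a separation.
    ... | true  | false = ⊥-elim (tight-⊕ (here refl) good tf tg fa ga
            ((y , (λ { refl → true≢false fy fx }) , cong₂ _xor_ fy gy) , (proj₁ a , All.head Y≢x , a-same)))
    ... | false | true  = ⊥-elim (tight-⊕ (here refl) good tf tg fa ga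
            ((y , (λ { refl → true≢false gy gx }) , cong₂ _xor_ fy gy) , (proj₁ a , All.head Y≢x , a-same)))

  -- `nothing` means that no partner blocked by a label of this kind has been met so far.
  covers : ∀ {t} → Maybe (Core t) → Half n → Bool
  covers nothing            b = false
  covers {t} (just (f , _)) b = crosses t f (x , b)

  Blocks : Bool → Half n → Set
  Blocks t b = Blocked (_≢ x) (x ∷ xs) E t (x , a) (x , b)

  add : ∀ t {b} (F : Maybe (Core t)) → Blocks t b →
        ∃[ G ] (covers {t} G b ≡ true × (∀ b′ → covers F b′ ≡ true → covers G b′ ≡ true))
  add t {b} F (f , tf , fa , fb) with normalise x tf
  ... | g , tg , gx , same = add′ F (g , tg , gx , trans (same _) fa) (trans (same _) fb)
    where
    add′ : ∀ F (G : Core t) → crosses t (proj₁ G) (x , b) ≡ true →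
           ∃[ H ] (covers {t} H b ≡ true × (∀ b′ → covers F b′ ≡ true → covers H b′ ≡ true))
    add′ nothing  G Gb = just G , Gb , λ _ ()
    add′ (just F) G Gb with merge t F G
    ... | H , h = just H , h b (inj₂ Gb) , λ b′ p → h b′ (inj₁ p)

  -- Repeated merging leaves one cut and one colouring that account for all blocked partners.
  covering : ∀ {Z} → All (λ b → Blocks false b ⊎ Blocks true b) Z →
    ∃[ F ] ∃[ G ] All (λ b → covers {false} F b ≡ true ⊎ covers {true} G b ≡ true) Z
  covering [] = nothing , nothing , []
  covering (p ∷ ps) with covering ps
  covering (inj₁ p ∷ ps) | F , G , all with add false F p
  ... | F′ , new , old = F′ , G , inj₁ new ∷ All.map (λ { (inj₁ q) → inj₁ (old _ q) ; (inj₂ q) → inj₂ q }) all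
  covering (inj₂ p ∷ ps) | F , G , all with add true G p
  ... | G′ , new , old = F , G′ , inj₂ new ∷ All.map (λ { (inj₁ q) → inj₁ q ; (inj₂ q) → inj₂ (old _ q) }) all

  covered : ∀ {t} → Maybe (Core t) → ℕ
  covered F = sumOver (λ b → bit (covers F b)) Y

  -- Each `suc` counts the edge a, which the label crosses as well, so this is `half-bound`. For
  -- `nothing` it says that the star has at least two edges.
  covered-bound : ∀ {t} (F : Maybe (Core t)) → 1 ≤ length Y → suc (covered F) + suc (covered F) ≤ suc (length Y)
  covered-bound nothing 1≤ = subst (λ c → suc c + suc c ≤ suc (length Y)) (sym (zero-sum Y)) (s≤s 1≤)
    where
    zero-sum : ∀ (Z : List (Half n)) → sumOver (λ _ → 0) Z ≡ 0
    zero-sum []      = refl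
    zero-sum (_ ∷ Z) = zero-sum Z
  covered-bound {t} F@(just (f , tf , _ , fa)) _ =
    subst (λ b → (bit b + covered F) + (bit b + covered F) ≤ suc (length Y)) fa (half-bound tf)

  -- With d = |a ∷ Y|, cuts block at most d/2 - 1 of the d - 1 partners of a, and so do 2-colourings.
  not-all-blocked : 1 ≤ length Y → ¬ All (λ b → Blocks false b ⊎ Blocks true b) Y
  not-all-blocked 1≤ blocked with covering blocked
  ... | F , G , all = <-irrefl refl (begin-strict
    L + L                                   <⟨ +-mono-< (n<1+n L) (n<1+n L) ⟩
    suc L + suc L                           ≤⟨ +-mono-≤ (s≤s (s≤s small)) (s≤s (s≤s small)) ⟩
    (2 + (F# + G#)) + (2 + (F# + G#))       ≡⟨ rearrange F# G# ⟩
    (suc F# + suc F#) + (suc G# + suc G#)   ≤⟨ +-mono-≤ (covered-bound F 1≤) (covered-bound G 1≤) ⟩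
    L + L                                   ∎)
    where
    open ≤-Reasoning
    L  = suc (length Y)
    F# = covered F
    G# = covered G
    rearrange : ∀ p q → (2 + (p + q)) + (2 + (p + q)) ≡ (suc p + suc p) + (suc q + suc q)
    rearrange = solve-∀
    one : ∀ {p q} → p ≡ true ⊎ q ≡ true → 1 ≤ bit p + bit q
    one (inj₁ refl)         = s≤s z≤n
    one {p} (inj₂ refl)     = m≤n+m 1 (bit p)
    small : length Y ≤ F# + G#
    small = begin
      length Y              ≡⟨ sym (sumOver-const1 Y) ⟩
      sumOver (λ _ → 1) Y   ≤⟨ sumOver-mono (All.map one all) ⟩
      sumOver (λ b → bit (covers F b) + bit (covers G b)) Y ≡⟨ sumOver-+ _ _ Y ⟩
      F# + G#               ∎

  Blocks? : ∀ t b → Dec (Blocks t b)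
  Blocks? t b = Blocked? (λ y → ¬? (y ≟ x)) t (x , a) (x , b)

  partner : 1 ≤ length Y → ∃[ b ] ∃[ Y′ ] (Y ↭ b ∷ Y′ × ∀ t → ¬ Blocks t b)
  partner 1≤ with find (¬All⇒Any¬ (λ b → Blocks? false b ⊎-dec Blocks? true b) Y (not-all-blocked 1≤))
  ... | b , b∈Y , free with ∈⇒↭ b∈Y
  ... | Y′ , p = b , Y′ , p , λ { false q → free (inj₁ q) ; true q → free (inj₂ q) }

-- Replacements at one vertex and the edges around it.

⇝-prep : ∀ e {E E′ : List (Edge n)} → E ⇝ E′ → e ∷ E ⇝ e ∷ E′
⇝-prep e {E} {E′} p = ⇝-trans (perm (++-comm (e ∷ []) E)) (⇝-trans (⇝-++ (e ∷ []) p) (perm (++-comm E′ (e ∷ []))))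

-- With `o` the indicator of a vertex other than x, `weight` says that the degree of this vertex is
-- preserved.
record SplitsAt (x : Fin n) (E E′ : List (Edge n)) : Set where
  field
    steps  : E ⇝ E′
    weight : ∀ o → o x ≡ 0 → W o E′ ≡ W o E
open SplitsAt

splits-trans : ∀ {x : Fin n} {E E′ E″} → SplitsAt x E E′ → SplitsAt x E′ E″ → SplitsAt x E E″
splits-trans p q = record
  { steps = ⇝-trans (steps p) (steps q) ; weight = λ o ox → trans (weight q o ox) (weight p o ox) }

splits-↭ : ∀ {x : Fin n} {E E′} → E ↭ E′ → SplitsAt x E E′
splits-↭ p = record { steps = perm p ; weight = λ o _ → sym (sumOver-↭ _ p) }

splits-join : ∀ {x : Fin n} a b {E} → SplitsAt x ((x , a) ∷ (x , b) ∷ E) ((proj₁ a , proj₁ b , proj₂ a xor proj₂ b) ∷ E)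
splits-join (y , s) (z , s′) {E} = record
  { steps  = ⇝-trans flip join
  ; weight = λ o ox → trans (lemma (o y) (o z) (W o E)) (cong (λ m → (m + o y) + ((m + o z) + W o E)) (sym ox))
  }
  where
  lemma : ∀ p q r → (p + q) + r ≡ p + (q + r)
  lemma = solve-∀

loop : Fin n → Bool → Edge n
loop x ℓ = x , x , ℓ

-- The edges sorted by whether both ends, one end or no end is x, those of the star being turned to
-- start at x. Turning is not a permutation, hence the separate field `same-N`.
record Around (x : Fin n) (E : List (Edge n)) : Set where
  field
    loops  : List Bool
    star   : List (Half n)
    rest   : List (Edge n)
    splits : SplitsAt x E (map (loop x) loops ++ stars x star ++ rest)
    same-N : ∀ t f → N t f E ≡ N t f (map (loop x) loops ++ stars x star ++ rest)
    star≢  : All (λ h → proj₁ h ≢ x) star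
    rest≢  : All (Avoids x) rest

around : ∀ (x : Fin n) E → Around x E
around x [] = record
  { loops = [] ; star = [] ; rest = [] ; splits = splits-↭ ↭-refl ; same-N = λ _ _ → refl ; star≢ = [] ; rest≢ = [] }
around {n} x ((u , w , s) ∷ E) = go (u ≟ x) (w ≟ x)
  where
  open Around (around x E)
  E₀ = map (loop x) loops ++ stars x star ++ rest

  prep-splits : ∀ e → SplitsAt x (e ∷ E) (e ∷ E₀)
  prep-splits e = record { steps = ⇝-prep e (steps splits) ; weight = λ o ox → cong (_ +_) (weight splits o ox) }

  to-star : ∀ h → (x , h) ∷ E₀ ↭ map (loop x) loops ++ stars x (h ∷ star) ++ rest
  to-star h = ↭-sym (shift (x , h) (map (loop x) loops) _)

  go : Dec (u ≡ x) → Dec (w ≡ x) → Around x ((u , w , s) ∷ E)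
  go (yes refl) (yes refl) = record
    { loops = s ∷ loops ; star = star ; rest = rest ; splits = prep-splits _
    ; same-N = λ t f → cong (_ +_) (same-N t f) ; star≢ = star≢ ; rest≢ = rest≢ }
  go (yes refl) (no w≢x) = record
    { loops = loops ; star = (w , s) ∷ star ; rest = rest
    ; splits = splits-trans (prep-splits _) (splits-↭ (to-star (w , s)))
    ; same-N = λ t f → trans (cong (_ +_) (same-N t f)) (sumOver-↭ _ (to-star (w , s)))
    ; star≢ = w≢x ∷ star≢ ; rest≢ = rest≢ }
  go (no u≢x) (yes refl) = record
    { loops = loops ; star = (u , s) ∷ star ; rest = rest
    ; splits = splits-trans (record { steps = flip ; weight = λ o _ → cong (_+ W o E) (+-comm (o x) (o u)) })
                 (splits-trans (prep-splits _) (splits-↭ (to-star (u , s))))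
    ; same-N = λ t f → trans (cong₂ _+_ (cong bit (crosses-flip t f u x s)) (same-N t f)) (sumOver-↭ _ (to-star (u , s)))
    ; star≢ = u≢x ∷ star≢ ; rest≢ = rest≢ }
  go (no u≢x) (no w≢x) = record
    { loops = loops ; star = star ; rest = (u , w , s) ∷ rest
    ; splits = splits-trans (prep-splits _) (splits-↭ to-rest)
    ; same-N = λ t f → trans (cong (_ +_) (same-N t f)) (sumOver-↭ _ to-rest)
    ; star≢ = star≢ ; rest≢ = (u≢x , w≢x) ∷ rest≢ }
    where
    to-rest : (u , w , s) ∷ E₀ ↭ map (loop x) loops ++ stars x star ++ (u , w , s) ∷ rest
    to-rest = ↭-trans (↭-sym (shift _ (map (loop x) loops) _)) (++⁺ˡ (map (loop x) loops) (↭-sym (shift _ (stars x star) rest)))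

singleton : Fin n → Label n
singleton x y = does (y ≟ x)

singleton-≡ : ∀ (x : Fin n) → singleton x x ≡ true
singleton-≡ x = dec-true (x ≟ x) refl

singleton-≢ : ∀ {x y : Fin n} → y ≢ x → singleton x y ≡ false
singleton-≢ {x = x} {y} y≢x = dec-false (y ≟ x) y≢x

count-singleton : ∀ {x : Fin n} {Y} → All (λ h → proj₁ h ≢ x) Y → count false (singleton x) x Y ≡ length Y
count-singleton {x = x} {Y} Y≢x = trans (sumOver-cong (All.map (λ {h} → one {h}) Y≢x)) (sumOver-const1 Y)
  where
  one : ∀ {h} → proj₁ h ≢ x → bit (crosses false (singleton x) (x , h)) ≡ 1
  one h≢x rewrite singleton-≡ x | singleton-≢ h≢x = refl

uncut-loops : ∀ (x : Fin n) f ls → N false f (map (loop x) ls) ≡ 0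
uncut-loops x f []       = refl
uncut-loops x f (ℓ ∷ ls) rewrite xor-same (f x) = uncut-loops x f ls

xor-cancel : ∀ a b → a xor b ≡ false → a ≡ b
xor-cancel true  true  _ = refl
xor-cancel false false _ = refl

mask : Fin n → (Fin n → ℕ) → Fin n → ℕ
mask x o y = if singleton x y then 0 else o y

-- Splitting off preserves only weights that vanish at the vertex. Once no edge is left there,
-- setting the weight to 0 changes no sum, so any weight can be traced back through all splittings.
mask-all : List (Fin n) → (Fin n → ℕ) → Fin n → ℕ
mask-all []       o = o
mask-all (x ∷ xs) o = mask x (mask-all xs o)

W-mask : ∀ {x : Fin n} {E} o → All (Avoids x) E → W o E ≡ W (mask x o) E
W-mask {x = x} o av = sumOver-cong (All.map (λ { (p , q) → cong₂ _+_ (m p) (m q) }) av)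
  where
  m : ∀ {y} → y ≢ x → o y ≡ mask x o y
  m y≢x rewrite singleton-≢ y≢x = refl

-- Absorbing loops, splitting off one vertex, splitting off a whole list.

module Vertex {n} (k : ℕ) (root : Fin n) where

  open Reduction k root
  open Uncross k root

  Everywhere : Fin n → Set
  Everywhere _ = ⊤

  -- The star is the cut around x, in which loops do not lie.
  star-degree : ∀ {x xs} ls {Y R} → root ≢ x → All (λ h → proj₁ h ≢ x) Y → All (Avoids x) R →
    Good Everywhere (x ∷ xs) (map (loop x) ls ++ stars x Y ++ R) → k + k ≼ length Y
  star-degree {x} {xs} ls {Y} {R} r≢x Y≢x R≢x good = subst (k + k ≼_) value′
    (good false (singleton x) allowed′ (λ _ → (x , tt , singleton-≡ x) , (root , tt , singleton-≢ r≢x)))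
    where
    open ≡-Reasoning
    allowed′ : Allowed (x ∷ xs) (singleton x)
    allowed′ y y∉ = trans (singleton-≢ {x = x} {y} (λ { refl → y∉ (here refl) })) (sym (singleton-≢ r≢x))
    zeros : ∀ Z → N false (λ _ → false) Z ≡ 0
    zeros []      = refl
    zeros (e ∷ Z) = zeros Z
    value′ : N false (singleton x) (map (loop x) ls ++ stars x Y ++ R) ≡ length Y
    value′ = begin
      N false (singleton x) (map (loop x) ls ++ stars x Y ++ R)
        ≡⟨ sumOver-++ _ (map (loop x) ls) _ ⟩
      N false (singleton x) (map (loop x) ls) + N false (singleton x) (stars x Y ++ R)
        ≡⟨ cong₂ _+_ (uncut-loops x (singleton x) ls) (N-stars false (singleton x) x Y R) ⟩
      count false (singleton x) x Y + N false (singleton x) R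
        ≡⟨ cong₂ _+_ (count-singleton Y≢x) (trans (N-avoids false {g = λ _ → false} singleton-≢ R≢x) (zeros R)) ⟩
      length Y + 0 ≡⟨ +-identityʳ _ ⟩
      length Y ∎

  module Absorb {x : Fin n} {xs : List (Fin n)} {ℓ : Bool} {Y : List (Half n)} {R : List (Edge n)}
    (1≤k : 1 ≤ k) (k+k≤ : k + k ≤ length Y)
    (good : Good Everywhere (x ∷ xs) (loop x ℓ ∷ stars x Y ++ R)) where

    E : List (Edge n)
    E = loop x ℓ ∷ stars x Y ++ R

    Blocks : Bool → Half n → Set
    Blocks t b = Blocked Everywhere (x ∷ xs) E t (loop x ℓ) (x , b)

    loop-crosses : ∀ t f → crosses t f (loop x ℓ) ≡ true → t ≡ true
    loop-crosses true  f p = refl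
    loop-crosses false f p rewrite xor-same (f x) = p

    Core : Set
    Core = ∃[ f ] (Tight Everywhere (x ∷ xs) E true f × f x ≡ false × crosses true f (loop x ℓ) ≡ true)

    label : Core → Label n
    label = proj₁

    core : ∀ {t b} → Blocks t b → ∃[ F ] (crosses true (label F) (x , b) ≡ true)
    core {t} (f , tf , cℓ , cb) with loop-crosses t f cℓ
    ... | refl with normalise x tf
    ... | g , tg , gx , same = (g , tg , gx , trans (same _) cℓ) , trans (same _) cb

    -- Both are false at x, so a vertex where they differ would let their sum separate, against
    -- `tight-⊕`.
    core-unique : (F G : Core) → ∀ y → proj₁ F y ≡ proj₁ G y
    core-unique (f , tf , fx , cf) (g , tg , gx , cg) y with f y xor g y in eq
    ... | false = xor-cancel _ _ eq
    ... | true  = ⊥-elim (tight-⊕ (here refl) good tf tg cf cg ((y , tt , eq) , (x , tt , cong₂ _xor_ fx gx)))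

    -- A loop lies in no cut, so only colourings block it, and these are all one colouring with k
    -- violations. It cannot be violated by all of the at least 2k edges of the star.
    not-all-blocked : ¬ All (λ b → Blocks false b ⊎ Blocks true b) Y
    not-all-blocked blocked = contradictory (first blocked k+k≤)
      where
      core⊎ : ∀ {b} → Blocks false b ⊎ Blocks true b → ∃[ F ] (crosses true (label F) (x , b) ≡ true)
      core⊎ {b} (inj₁ p) = core {false} {b} p
      core⊎ {b} (inj₂ p) = core {true} {b} p
      first : ∀ {Z} → All (λ b → Blocks false b ⊎ Blocks true b) Z → k + k ≤ length Z → Core
      first []      k+k≤0 with ≤-trans 1≤k (≤-trans (m≤m+n k k) k+k≤0)
      ... | ()
      first (p ∷ _) _     = proj₁ (core⊎ p)
      contradictory : Core → ⊥
      contradictory F@(f , tf , fx , cf) = <-irrefl refl (begin-strict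
        k                          <⟨ m<m+n k 1≤k ⟩
        k + k                      ≤⟨ k+k≤ ⟩
        length Y                   ≡⟨ sym (sumOver-const1 Y) ⟩
        sumOver (λ _ → 1) Y        ≤⟨ sumOver-mono (All.map (λ {b} p → ≤-reflexive (cong bit (sym (crossed b p)))) blocked) ⟩
        count true f x Y           ≤⟨ m≤m+n _ _ ⟩
        count true f x Y + N true f R ≡⟨ sym (N-stars true f x Y R) ⟩
        N true f (stars x Y ++ R)  ≤⟨ m≤n+m _ _ ⟩
        N true f E                 ≡⟨ value tf ⟩
        k                          ∎)
        where
        open ≤-Reasoning
        crossed : ∀ b → Blocks false b ⊎ Blocks true b → crosses true f (x , b) ≡ true
        crossed (y , s) p with core⊎ p
        ... | G , cb = trans (crosses-cong true f (proj₁ G) x y s (core-unique F G x) (core-unique F G y)) cb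

    partner : ∃[ b ] ∃[ Y′ ] (Y ↭ b ∷ Y′ × ∀ t → ¬ Blocks t b)
    partner with find (¬All⇒Any¬ (λ b → blocks? false b ⊎-dec blocks? true b) Y not-all-blocked)
      where
      blocks? : ∀ t b → Dec (Blocks t b)
      blocks? t b = Blocked? (λ _ → yes tt) t (loop x ℓ) (x , b)
    ... | b , b∈Y , free with ∈⇒↭ b∈Y
    ... | Y′ , p = b , Y′ , p , λ { false q → free (inj₁ q) ; true q → free (inj₂ q) }

  stars-↭ : ∀ {x : Fin n} {Y Y′} R → Y ↭ Y′ → stars x Y ++ R ↭ stars x Y′ ++ R
  stars-↭ R p = ++⁺ʳ R (↭-map⁺ _ p)

  -- A loop merged with an edge of the star gives an edge of the star again, so the star keeps its
  -- size while the loops disappear one by one.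
  absorb-loops : ∀ {x xs} → 1 ≤ k → root ≢ x → ∀ ls Y R →
    All (λ h → proj₁ h ≢ x) Y → All (Avoids x) R →
    Good Everywhere (x ∷ xs) (map (loop x) ls ++ stars x Y ++ R) →
    ∃[ Y′ ] (SplitsAt x (map (loop x) ls ++ stars x Y ++ R) (stars x Y′ ++ R)
             × Good Everywhere (x ∷ xs) (stars x Y′ ++ R) × All (λ h → proj₁ h ≢ x) Y′)
  absorb-loops 1≤k r≢x []       Y R Y≢x R≢x good = Y , splits-↭ ↭-refl , good , Y≢x
  absorb-loops {x} {xs} 1≤k r≢x (ℓ ∷ ls) Y R Y≢x R≢x good =
    absorb (Absorb.partner 1≤k (≼⇒≤ (star-degree (ℓ ∷ ls) r≢x Y≢x R≢x good)) (Good-↭ front good))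
    where
    L = map (loop x) ls
    front : loop x ℓ ∷ L ++ stars x Y ++ R ↭ loop x ℓ ∷ stars x Y ++ (L ++ R)
    front = prep _ (shifts L (stars x Y))
    absorb : (∃[ b ] ∃[ Y′ ] (Y ↭ b ∷ Y′ × ∀ t → ¬ Blocked Everywhere (x ∷ xs) (loop x ℓ ∷ stars x Y ++ (L ++ R)) t (loop x ℓ) (x , b))) →
      ∃[ Z ] (SplitsAt x (loop x ℓ ∷ L ++ stars x Y ++ R) (stars x Z ++ R)
              × Good Everywhere (x ∷ xs) (stars x Z ++ R) × All (λ h → proj₁ h ≢ x) Z)
    absorb (b , Y′ , Y↭ , free) =
     let Z , sp , g , Z≢x = absorb-loops 1≤k r≢x ls (c ∷ Y′) R (All.head bY′≢x ∷ All.tail bY′≢x) R≢x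
                              (Good-↭ to-star good-c)
     in Z , splits-trans (splits-trans (splits-↭ (↭-trans front pull)) (splits-trans (splits-join (x , ℓ) b) (splits-↭ to-star))) sp , g , Z≢x
     where
     c = (proj₁ b , ℓ xor proj₂ b)
     rest = stars x Y′ ++ (L ++ R)
     bY′≢x = All-resp-↭ Y↭ Y≢x
     pull : loop x ℓ ∷ stars x Y ++ (L ++ R) ↭ loop x ℓ ∷ (x , b) ∷ rest
     pull = prep _ (stars-↭ (L ++ R) Y↭)
     good-c : Good Everywhere (x ∷ xs) ((x , c) ∷ rest)
     good-c = Good-join {x = x} (x , ℓ) b {E = rest} (Good-↭ (↭-trans front pull) good)
       (λ t f tf cℓ cb → free t (f , tight (allowed tf) (separates tf) (trans (sumOver-↭ _ pull) (value tf)) , cℓ , cb))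
     to-star : (x , c) ∷ rest ↭ L ++ stars x (c ∷ Y′) ++ R
     to-star = shifts (stars x (c ∷ Y′)) L

  -- In each round the first edge is merged with a free partner; the new edge avoids x and joins
  -- `R`.
  split-star : ∀ {x xs} → root ≢ x → ∀ h Y R → length Y ≡ h + h →
    All (λ y → proj₁ y ≢ x) Y → All (Avoids x) R → Good (_≢ x) (x ∷ xs) (stars x Y ++ R) →
    ∃[ E′ ] (SplitsAt x (stars x Y ++ R) E′ × Good (_≢ x) (x ∷ xs) E′ × All (Avoids x) E′)
  split-star r≢x zero    []      R eq Y≢x R≢x good = R , splits-↭ ↭-refl , good , R≢x
  split-star {x} {xs} r≢x (suc h) (a ∷ Y) R eq Y≢x R≢x good =
    pair (Star.partner k root x xs a Y R r≢x Y≢x R≢x good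
           (subst (1 ≤_) (sym (trans (suc-injective eq) (+-suc h h))) (s≤s z≤n)))
    where
    pair : (∃[ b ] ∃[ Y′ ] (Y ↭ b ∷ Y′ × ∀ t → ¬ Blocked (_≢ x) (x ∷ xs) (stars x (a ∷ Y) ++ R) t (x , a) (x , b))) →
      ∃[ E′ ] (SplitsAt x (stars x (a ∷ Y) ++ R) E′ × Good (_≢ x) (x ∷ xs) E′ × All (Avoids x) E′)
    pair (b , Y′ , Y↭ , free) =
     let E′ , sp , g , av = split-star r≢x h Y′ (e ∷ R) len (All.tail bY′≢x) ((All.head Y≢x , All.head bY′≢x) ∷ R≢x)
                              (Good-↭ to-rest good-e)
     in E′ , splits-trans (splits-trans (splits-↭ pull) (splits-trans (splits-join a b) (splits-↭ to-rest))) sp , g , av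
     where
     bY′≢x = All-resp-↭ Y↭ (All.tail Y≢x)
     e = (proj₁ a , proj₁ b , proj₂ a xor proj₂ b)
     len : length Y′ ≡ h + h
     len = suc-injective (trans (sym (↭-length Y↭)) (trans (suc-injective eq) (+-suc h h)))
     pull : stars x (a ∷ Y) ++ R ↭ (x , a) ∷ (x , b) ∷ stars x Y′ ++ R
     pull = prep _ (stars-↭ R Y↭)
     good-e : Good (_≢ x) (x ∷ xs) (e ∷ stars x Y′ ++ R)
     good-e = Good-join {x = x} a b {E = stars x Y′ ++ R} (Good-↭ pull good)
       (λ t f tf ca cb → free t (f , tight (allowed tf) (separates tf) (trans (sumOver-↭ _ pull) (value tf)) , ca , cb))
     to-rest : e ∷ stars x Y′ ++ R ↭ stars x Y′ ++ e ∷ R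
     to-rest = ↭-sym (shift e (stars x Y′) R)

  even-half : ∀ {m} → k + k ≼ m → ∃[ h ] m ≡ h + h
  even-half here   = k , refl
  even-half (up p) with even-half p
  ... | h , refl = suc h , cong suc (sym (+-suc h h))

  split-off : ∀ {x xs E} → 1 ≤ k → root ≢ x → root ∉ xs → x ∉ xs → Good Everywhere (x ∷ xs) E →
    ∃[ E′ ] (SplitsAt x E E′ × Good Everywhere xs E′ × All (Avoids x) E′)
  split-off {x} {xs} {E} 1≤k r≢x r∉xs x∉xs good =
    E₂ , splits-trans splits (splits-trans sp₁ sp₂) , good₂′ , av₂
    where
    open Around (around x E)
    absorbed = absorb-loops 1≤k r≢x loops star rest star≢ rest≢
      (λ t f al sep → subst (threshold t ≼_) (same-N t f) (good t f al sep))
    Y₁    = proj₁ absorbed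
    sp₁   = proj₁ (proj₂ absorbed)
    good₁ = proj₁ (proj₂ (proj₂ absorbed))
    Y₁≢x  = proj₂ (proj₂ (proj₂ absorbed))
    half = even-half (star-degree [] r≢x Y₁≢x rest≢ good₁)
    split = split-star r≢x (proj₁ half) Y₁ rest (proj₂ half) Y₁≢x rest≢
      (λ t f al sep → good₁ t f al (λ e → let ((y , _ , p) , (z , _ , q)) = sep e in (y , tt , p) , (z , tt , q)))
    E₂ = proj₁ split
    sp₂ = proj₁ (proj₂ split)
    good₂ = proj₁ (proj₂ (proj₂ split))
    av₂ = proj₂ (proj₂ (proj₂ split))
    -- With x no longer among the split vertices, an allowed label has the same value at x as at
    -- `root`, so `root` replaces x as a separated vertex.
    good₂′ : Good Everywhere xs E₂
    good₂′ t f al sep = good₂ t f (λ y y∉ → al y (λ y∈ → y∉ (there y∈)))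
      (λ e → let ((y , _ , p) , (z , _ , q)) = sep e in off-x y p , off-x z q)
      where
      off-x : ∀ y {b} → f y ≡ b → ∃[ y′ ] (y′ ≢ x × f y′ ≡ b)
      off-x y p with y ≟ x
      ... | no y≢x   = y , y≢x , p
      ... | yes refl = root , r≢x , trans (sym (al x x∉xs)) p

  -- At the end only constant labels are allowed. The edges violating a constant colouring are the
  -- odd ones, so the invariant then bounds the number of odd edges from below.
  split-off-all : ∀ {xs E} → 1 ≤ k → Unique xs → root ∉ xs → Good Everywhere xs E →
    ∃[ E′ ] (E ⇝ E′ × Good Everywhere [] E′ × (∀ o → W o E′ ≡ W (mask-all xs o) E))
  split-off-all {[]}     {E} 1≤k uniq r∉ good = E , perm ↭-refl , good , λ _ → refl
  split-off-all {x ∷ xs} 1≤k uniq@(_ ∷ uniq′) r∉ good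
    with split-off 1≤k (λ { refl → r∉ (here refl) }) (λ r∈ → r∉ (there r∈)) (Unique[x∷xs]⇒x∉xs uniq) good
  ... | E₁ , sp , good₁ , av with split-off-all 1≤k uniq′ (λ r∈ → r∉ (there r∈)) good₁
  ... | E′ , st , good′ , wt = E′ , ⇝-trans (steps sp) st , good′ , λ o →
        trans (wt o) (trans (W-mask (mask-all xs o) av) (weight sp (mask x (mask-all xs o)) (masked (mask-all xs o))))
    where
    masked : ∀ o → mask x o x ≡ 0
    masked o rewrite singleton-≡ x = refl

-- Minimum cuts

∑-cong : ∀ m {f g : Fin m → ℕ} → (∀ i → f i ≡ g i) → ∑ m f ≡ ∑ m g
∑-cong zero    h = refl
∑-cong (suc m) h = cong₂ _+_ (h zero) (∑-cong m (h ∘ suc))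

∑-0 : ∀ m → ∑ m (λ _ → 0) ≡ 0
∑-0 zero    = refl
∑-0 (suc m) = ∑-0 m

∑-+ : ∀ m (f g : Fin m → ℕ) → ∑ m (λ i → f i + g i) ≡ ∑ m f + ∑ m g
∑-+ zero    f g = refl
∑-+ (suc m) f g = trans (cong (f zero + g zero +_) (∑-+ m (f ∘ suc) (g ∘ suc))) (interchange (f zero) (g zero) _ _)

∑-* : ∀ m c (f : Fin m → ℕ) → ∑ m (λ i → c * f i) ≡ c * ∑ m f
∑-* zero    c f = sym (*-zeroʳ c)
∑-* (suc m) c f = trans (cong (c * f zero +_) (∑-* m c (f ∘ suc))) (sym (*-distribˡ-+ c (f zero) _))

∑-member : ∀ {m} (f : Fin m → ℕ) i → f i ≤ ∑ m f
∑-member f zero    = m≤m+n _ _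
∑-member f (suc i) = ≤-trans (∑-member (f ∘ suc) i) (m≤n+m _ _)

∑-pick : ∀ {m} (o : Fin m → ℕ) u → ∑ m (λ y → o y * bit (singleton y u)) ≡ o u
∑-pick {suc m} o zero = begin
  o zero * 1 + ∑ m (λ y → o (suc y) * 0) ≡⟨ cong₂ _+_ (*-identityʳ _) (trans (∑-cong m (λ y → *-zeroʳ (o (suc y)))) (∑-0 m)) ⟩
  o zero + 0                             ≡⟨ +-identityʳ _ ⟩
  o zero                                 ∎
  where open ≡-Reasoning
∑-pick {suc m} o (suc u) = cong₂ _+_ (*-zeroʳ (o zero)) (∑-pick (o ∘ suc) u)

size# : Label n → ℕ
size# {n} V = ∑ n (λ y → bit (V y))

size#-split : ∀ (g V : Label n) → size# V ≡ size# (λ y → g y ∧ V y) + size# (λ y → not (g y) ∧ V y)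
size#-split {n} g V = trans (∑-cong n (λ y → split (g y) (V y))) (∑-+ n _ _)
  where
  split : ∀ a v → bit v ≡ bit (a ∧ v) + bit (not a ∧ v)
  split true  v = sym (+-identityʳ (bit v))
  split false v = refl

-- As a weight this makes `W (δ y) E` the degree of y, a loop counting twice.
δ : Fin n → Fin n → ℕ
δ y u = bit (singleton y u)

-- Double counting of edge ends.
W-degrees : ∀ (o : Fin n → ℕ) E → W o E ≡ ∑ n (λ y → o y * W (δ y) E)
W-degrees {n} o []              = sym (trans (∑-cong n (λ y → *-zeroʳ (o y))) (∑-0 n))
W-degrees {n} o ((u , w , s) ∷ E) = sym (begin
  ∑ n (λ y → o y * ((δ y u + δ y w) + W (δ y) E))
    ≡⟨ ∑-cong n (λ y → distrib (o y) (δ y u) (δ y w) (W (δ y) E)) ⟩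
  ∑ n (λ y → (o y * δ y u + o y * δ y w) + o y * W (δ y) E)
    ≡⟨ trans (∑-+ n _ _) (cong₂ _+_ (∑-+ n _ _) (sym (W-degrees o E))) ⟩
  (∑ n (λ y → o y * δ y u) + ∑ n (λ y → o y * δ y w)) + W o E
    ≡⟨ cong (_+ W o E) (cong₂ _+_ (∑-pick o u) (∑-pick o w)) ⟩
  (o u + o w) + W o E ∎)
  where
  open ≡-Reasoning
  distrib : ∀ a b c d → a * ((b + c) + d) ≡ (a * b + a * c) + a * d
  distrib = solve-∀

sumOver-member : ∀ {A : Set} (φ : A → ℕ) {x xs} → x ∈ xs → φ x ≤ sumOver φ xs
sumOver-member φ (here refl) = m≤m+n _ _
sumOver-member φ (there p)   = ≤-trans (sumOver-member φ p) (m≤n+m _ _)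

sumOver-0 : ∀ {A : Set} {φ : A → ℕ} {xs} → All (λ x → φ x ≡ 0) xs → sumOver φ xs ≡ 0
sumOver-0 []       = refl
sumOver-0 (p ∷ ps) = cong₂ _+_ p (sumOver-0 ps)

-- Parity arithmetic.

Even# : ℕ → Set
Even# a = ∃[ h ] a ≡ h + h

Odd# : ℕ → Set
Odd# a = ∃[ h ] a ≡ suc (h + h)

even-cancel : ∀ {a} b c → a + (b + b) ≡ c + c → Even# a
even-cancel {a} zero    c       eq = c , trans (sym (+-identityʳ a)) eq
even-cancel {a} (suc b) zero    eq with trans (sym (+-suc a (b + suc b))) eq
... | ()
even-cancel {a} (suc b) (suc c) eq = even-cancel b c (suc-injective (suc-injective (begin
  suc (suc (a + (b + b)))   ≡⟨ sym (shift₂ a b) ⟩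
  a + (suc b + suc b)       ≡⟨ eq ⟩
  suc c + suc c             ≡⟨ cong suc (+-suc c c) ⟩
  suc (suc (c + c))         ∎)))
  where
  open ≡-Reasoning
  shift₂ : ∀ a b → a + (suc b + suc b) ≡ suc (suc (a + (b + b)))
  shift₂ = solve-∀

parity : ∀ a → Even# a ⊎ Odd# a
parity zero = inj₁ (0 , refl)
parity (suc a) with parity a
... | inj₁ (h , eq) = inj₂ (h , cong suc eq)
... | inj₂ (h , eq) = inj₁ (suc h , cong suc (trans eq (sym (+-suc h h))))

odd-sum : ∀ {a b} → Odd# (a + b) → (Even# a × Odd# b) ⊎ (Even# b × Odd# a)
odd-sum {a} {b} (h , eq) with parity a
... | inj₁ ea@(j , refl) = inj₁ (ea , odd-b j h b eq)
  where
  odd-b : ∀ j h b → j + j + b ≡ suc (h + h) → Odd# b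
  odd-b j h b eq with parity b
  ... | inj₂ ob = ob
  ... | inj₁ (i , refl) with even-cancel {1} h (j + i) (trans (sym eq) (interchange j j i i))
  ... | zero , ()
  ... | suc m , eq′ with trans eq′ (cong suc (+-suc m m))
  ... | ()
... | inj₂ oa@(j , refl) = inj₂ (even-cancel j h (suc-injective (trans (cong suc (+-comm b (j + j))) eq)) , oa)

double-≤ : ∀ {a b} → a + a ≤ b + b → a ≤ b
double-≤ {a} {b} p = ≮⇒≥ (λ b<a → <-irrefl refl (<-≤-trans (+-mono-< b<a b<a) p))

≼-even : ∀ {k N} → k + k ≤ N → Even# N → k + k ≼ N
≼-even {k} p (h , refl) = ≼-intro (h ∸ k)
  (trans (cong₂ _+_ (sym e) (sym e)) (interchange (h ∸ k) k (h ∸ k) k))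
  where
  e : h ∸ k + k ≡ h
  e = m∸n+n≡m (double-≤ {k} {h} p)

-- Here p and q count the violated edges on the two sides of a 2-colouring with sides of size A and B.
≼-balance : ∀ {k} A B p q → k ≤ 3 → Even# (A + B) → 6 * A + (p + p) ≡ 6 * B + (k + k) + (q + q) → k ≼ p + q
≼-balance {k} A B p q k≤3 (h , A+B) eq with ≤-total A B
... | inj₁ A≤B with even-cancel {B ∸ A} A h (trans (trans (sym (+-assoc (B ∸ A) A A)) (trans (cong (_+ A) (m∸n+n≡m A≤B)) (+-comm B A))) A+B)
-- Here B = A + 2j, and the equation gives p = 6j + k + q.
... | j , d = ≼-intro (3 * j + q) (begin
  p + q                       ≡⟨ cong (_+ q) p-eq ⟩
  3 * j + 3 * j + k + q + q   ≡⟨ rearrange j k q ⟩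
  3 * j + q + (3 * j + q) + k ∎)
  where
  open ≡-Reasoning
  rearrange : ∀ j k q → 3 * j + 3 * j + k + q + q ≡ 3 * j + q + (3 * j + q) + k
  rearrange = solve-∀
  expand : ∀ j A k q → 6 * (j + j + A) + (k + k) + (q + q) ≡ 6 * A + ((3 * j + 3 * j + k + q) + (3 * j + 3 * j + k + q))
  expand = solve-∀
  B-eq : B ≡ j + j + A
  B-eq = trans (sym (m∸n+n≡m A≤B)) (cong (_+ A) d)
  pp : p + p ≡ (3 * j + 3 * j + k + q) + (3 * j + 3 * j + k + q)
  pp = +-cancelˡ-≡ (6 * A) _ _ (trans eq (trans (cong (λ z → 6 * z + (k + k) + (q + q)) B-eq) (expand j A k q)))
  p-eq : p ≡ 3 * j + 3 * j + k + q
  p-eq = ≤-antisym (double-≤ (≤-reflexive pp)) (double-≤ (≤-reflexive (sym pp)))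
≼-balance {k} A B p q k≤3 (h , A+B) eq | inj₂ B≤A with even-cancel {A ∸ B} B h (trans (trans (sym (+-assoc (A ∸ B) B B)) (cong (_+ B) (m∸n+n≡m B≤A))) A+B)
-- Here A = B + 2j, and the equation gives q = 3j + r with r = p + 3j - k.
... | j , d = ≼-intro r (begin
  p + q                 ≡⟨ cong (p +_) q-eq ⟩
  p + (3 * j + r)       ≡⟨ sym (+-assoc p (3 * j) r) ⟩
  p + 3 * j + r         ≡⟨ cong (_+ r) (sym r-eq) ⟩
  r + k + r             ≡⟨ trans (+-assoc r k r) (trans (cong (r +_) (+-comm k r)) (sym (+-assoc r r k))) ⟩
  r + r + k             ∎)
  where
  open ≡-Reasoning
  expand : ∀ j B p → 6 * (j + j + B) + (p + p) ≡ 6 * B + ((3 * j + (p + 3 * j)) + (3 * j + (p + 3 * j)))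
  expand = solve-∀
  collect : ∀ B k q → 6 * B + (k + k) + (q + q) ≡ 6 * B + ((k + q) + (k + q))
  collect = solve-∀
  A-eq : A ≡ j + j + B
  A-eq = trans (sym (m∸n+n≡m B≤A)) (cong (_+ B) d)
  doubled : (3 * j + (p + 3 * j)) + (3 * j + (p + 3 * j)) ≡ (k + q) + (k + q)
  doubled = +-cancelˡ-≡ (6 * B) _ _ (trans (sym (expand j B p))
              (trans (cong (λ z → 6 * z + (p + p)) (sym A-eq)) (trans eq (collect B k q))))
  kq : 3 * j + (p + 3 * j) ≡ k + q
  kq = ≤-antisym (double-≤ (≤-reflexive doubled)) (double-≤ (≤-reflexive (sym doubled)))
  -- This makes r a natural number: for j = 0 the equation reads p = k + q, and for positive j
  -- already k ≤ 3 ≤ 3j.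
  k≤ : ∀ j → 3 * j + (p + 3 * j) ≡ k + q → k ≤ p + 3 * j
  k≤ zero    e = ≤-trans (m≤m+n k q) (≤-reflexive (sym e))
  k≤ (suc j) e = ≤-trans k≤3 (≤-trans (*-monoʳ-≤ 3 (s≤s (z≤n {j}))) (m≤n+m (3 * suc j) p))
  r = p + 3 * j ∸ k
  r-eq : r + k ≡ p + 3 * j
  r-eq = m∸n+n≡m (k≤ j kq)
  q-eq : q ≡ 3 * j + r
  q-eq = +-cancelˡ-≡ k _ _ (trans (sym kq) (trans (cong (3 * j +_) (sym r-eq))
           (trans (sym (+-assoc (3 * j) r k)) (+-comm (3 * j + r) k))))

-- The first list is what contracting the complement of `S` leaves to work on; the second is set
-- aside and returns after the reduction.
touching : (S : Label n) (E : List (Edge n)) →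
  ∃[ E₁ ] ∃[ E₂ ] (E ↭ E₁ ++ E₂ × All (λ (u , w , _) → S u ∨ S w ≡ true) E₁
                               × All (λ (u , w , _) → S u ≡ false × S w ≡ false) E₂)
touching S [] = [] , [] , ↭-refl , [] , []
touching S (e@(u , w , _) ∷ E) with touching S E | S u in Su | S w in Sw
... | E₁ , E₂ , p , in₁ , in₂ | false | false = E₁ , e ∷ E₂ , ↭-trans (prep e p) (↭-sym (shift e E₁ E₂)) , in₁ , (Su , Sw) ∷ in₂
... | E₁ , E₂ , p , in₁ , in₂ | true  | b     = e ∷ E₁ , E₂ , prep e p , cong₂ _∨_ Su Sw ∷ in₁ , in₂
... | E₁ , E₂ , p , in₁ , in₂ | false | true  = e ∷ E₁ , E₂ , prep e p , cong₂ _∨_ Su Sw ∷ in₁ , in₂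

-- Descent from f: each improvement lowers the value, so b bounds the number of rounds.
argmin : {P : Label n → Set} → (∀ {f g} → (∀ y → f y ≡ g y) → P f → P g) → (∀ f → Dec (P f)) →
  (μ : Label n → ℕ) → (∀ {f g} → (∀ y → f y ≡ g y) → μ f ≡ μ g) → ∀ b f → P f → μ f ≤ b →
  ∃[ g ] (P g × μ g ≤ μ f × (∀ h → P h → μ g ≤ μ h))
argmin {P = P} resp P? μ μ-resp = go
  where
  smaller? : ∀ f → Dec (∃[ g ] (P g × μ g < μ f))
  smaller? f = anyLabel? (λ h (p , q) → resp h p , subst (_< μ f) (μ-resp h) q)
                         (λ g → P? g ×-dec (μ g ℕ.<? μ f))
  minimal : ∀ f → P f → ¬ (∃[ g ] (P g × μ g < μ f)) → ∃[ g ] (P g × μ g ≤ μ f × (∀ h → P h → μ g ≤ μ h))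
  minimal f pf none = f , pf , ≤-refl , λ h ph → ≮⇒≥ (λ lt → none (h , ph , lt))
  go : ∀ b f → P f → μ f ≤ b → ∃[ g ] (P g × μ g ≤ μ f × (∀ h → P h → μ g ≤ μ h))
  go b f pf μ≤b with smaller? f
  ... | no none = minimal f pf none
  go zero    f pf μ≤b | yes (g , pg , lt) with ≤-trans lt μ≤b
  ... | ()
  go (suc b) f pf μ≤b | yes (g , pg , lt) with go b g pg (≤-pred (≤-trans lt μ≤b))
  ... | m , pm , m≤g , min = m , pm , ≤-trans m≤g (<⇒≤ lt) , min

-- `V` is the set of vertices still present; removed ones stay in `Fin n` with degree 0.
-- Connectedness is stated through cuts, the form in which minimality of a cut yields it again.
record RegularOn (V : Label n) (E : List (Edge n)) : Set where
  field
    odd-signs : All Odd-sign E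
    degrees   : ∀ y → W (δ y) E ≡ 6 * bit (V y)
    connected : ∀ f → Separates (λ y → V y ≡ true) f → 1 ≤ N false f E

bit-≤1 : ∀ b → bit b ≤ 1
bit-≤1 true  = ≤-refl
bit-≤1 false = z≤n

-- A constant colouring is violated by exactly the odd edges.
all-odd : ∀ (E : List (Edge n)) → length E ≤ N true (λ _ → false) E → All Odd-sign E
all-odd []                    _ = []
all-odd ((u , w , true)  ∷ E) p = refl ∷ all-odd E (≤-pred p)
all-odd ((u , w , false) ∷ E) p = ⊥-elim (<-irrefl refl (≤-trans p (≤-trans (sumOver-mono (All.universal (λ _ → bit-≤1 _) E)) (≤-reflexive (sumOver-const1 E)))))

mask-∈ : ∀ xs (o : Fin n → ℕ) {y} → y ∈ xs → mask-all xs o y ≡ 0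
mask-∈ (x ∷ xs) o {y} (here refl) rewrite singleton-≡ x = refl
mask-∈ (x ∷ xs) o {y} (there p) with singleton x y
... | true  = refl
... | false = mask-∈ xs o p

mask-∉ : ∀ xs (o : Fin n → ℕ) {y} → y ∉ xs → mask-all xs o y ≡ o y
mask-∉ []       o y∉ = refl
mask-∉ (x ∷ xs) o {y} y∉ rewrite singleton-≢ {x = x} {y} (λ { refl → y∉ (here refl) }) = mask-∉ xs o (λ p → y∉ (there p))

-- Degrees and cuts in a 6-regular graph.

module Regularity {n} {V : Label n} {E : List (Edge n)} (reg : RegularOn V E) where

  open RegularOn reg

  inside : All (λ (u , w , _) → V u ≡ true × V w ≡ true) E
  inside = All.tabulate (λ { {u , w , s} e∈E →
    active u e∈E (≤-trans (≤-reflexive (cong bit (sym (singleton-≡ u)))) (m≤m+n _ _)) ,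
    active w e∈E (≤-trans (≤-reflexive (cong bit (sym (singleton-≡ w)))) (m≤n+m _ _)) })
    where
    active : ∀ y {u w s} → (u , w , s) ∈ E → 1 ≤ δ y u + δ y w → V y ≡ true
    active y e∈E 1≤ with V y in Vy
    ... | true  = refl
    ... | false with ≤-trans 1≤ (≤-trans (sumOver-member (λ (u , w , _) → δ y u + δ y w) e∈E)
                                   (≤-reflexive (trans (degrees y) (cong (λ b → 6 * bit b) Vy))))
    ... | ()

  W-size : ∀ f → (∀ y → f y ≡ true → V y ≡ true) → W (bit ∘ f) E ≡ 6 * size# f
  W-size f f⊆V = trans (W-degrees (bit ∘ f) E) (trans (∑-cong n term) (∑-* n 6 (bit ∘ f)))
    where
    term : ∀ y → bit (f y) * W (δ y) E ≡ 6 * bit (f y)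
    term y with f y in fy
    ... | true  = trans (+-identityʳ _) (trans (degrees y) (cong (λ b → 6 * bit b) (f⊆V y fy)))
    ... | false = refl

  N-inside : ∀ {f g} → (∀ y → V y ≡ true → f y ≡ g y) → N false f E ≡ N false g E
  N-inside {f} {g} h = sumOver-cong (All.map (λ { {u , w , s} (p , q) → cong bit (crosses-cong false f g u w s (h u p) (h w q)) }) inside)

  -- The degree sum over one side is a multiple of 6 and counts each edge of the cut once, each edge
  -- inside that side twice.
  cut-even : ∀ f → Even# (N false f E)
  cut-even f = even-cancel (sumOver both E) (3 * size# f∧V) (begin
    N false f E + (sumOver both E + sumOver both E)
      ≡⟨ cong₂ _+_ (N-inside (λ y Vy → trans (sym (∧-identityʳ (f y))) (cong (f y ∧_) (sym Vy)))) refl ⟩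
    N false f∧V E + (sumOver both E + sumOver both E)
      ≡⟨ cong (N false f∧V E +_) (sym (sumOver-+ both both E)) ⟩
    N false f∧V E + sumOver (λ e → both e + both e) E
      ≡⟨ sym (sumOver-+ _ _ E) ⟩
    sumOver (λ e → bit (crosses false f∧V e) + (both e + both e)) E
      ≡⟨ sumOver-cong (All.universal (λ (u , w , s) → edge (f∧V u) (f∧V w)) E) ⟩
    W (bit ∘ f∧V) E
      ≡⟨ W-size f∧V (λ y p → ∧-trueʳ (f y) p) ⟩
    6 * size# f∧V
      ≡⟨ six (size# f∧V) ⟩
    3 * size# f∧V + 3 * size# f∧V ∎)
    where
    open ≡-Reasoning
    f∧V : Label n
    f∧V y = f y ∧ V y
    both : Edge n → ℕ
    both (u , w , _) = bit (f∧V u ∧ f∧V w)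
    edge : ∀ a b → bit ((a xor b) xor false) + (bit (a ∧ b) + bit (a ∧ b)) ≡ bit a + bit b
    edge = toWitness {a? = ∀𝔹? λ a → ∀𝔹? λ b → (bit ((a xor b) xor false) + (bit (a ∧ b) + bit (a ∧ b))) ℕ.≟ (bit a + bit b)} tt
    six : ∀ m → 6 * m ≡ 3 * m + 3 * m
    six = solve-∀
    ∧-trueʳ : ∀ a {b} → a ∧ b ≡ true → b ≡ true
    ∧-trueʳ true p = p

  cut-degree : ∀ v → N false (singleton v) E ≤ W (δ v) E
  cut-degree v = sumOver-mono (All.universal (λ (u , w , _) → edge (singleton v u) (singleton v w)) E)
    where
    edge : ∀ a b → bit ((a xor b) xor false) ≤ bit a + bit b
    edge = toWitness {a? = ∀𝔹? λ a → ∀𝔹? λ b → bit ((a xor b) xor false) ≤? (bit a + bit b)} tt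

  -- All edges are loops at v, and each contributes 2 to the degree 6.
  one-vertex : ∀ v → (∀ y → V y ≡ true → y ≡ v) → V v ≡ true → E ≡ replicate 3 (loop v true)
  one-vertex v only Vv = three E loops-at-v (trans (degrees v) (cong (λ b → 6 * bit b) Vv))
    where
    loops-at-v : All (_≡ loop v true) E
    loops-at-v = All.zipWith (λ { {u , w , s} ((p , q) , refl) → cong₂ (λ a b → a , b , true) (only u p) (only w q) }) (inside , odd-signs)
    three : ∀ Z → All (_≡ loop v true) Z → W (δ v) Z ≡ 6 → Z ≡ replicate 3 (loop v true)
    three Z all deg = trans (repl Z all) (cong (λ m → replicate m (loop v true)) len)
      where
      repl : ∀ Z → All (_≡ loop v true) Z → Z ≡ replicate (length Z) (loop v true)
      repl []      []         = refl
      repl (e ∷ Z) (refl ∷ p) = cong (_ ∷_) (repl Z p)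
      twice : ∀ {Z} → All (_≡ loop v true) Z → W (δ v) Z ≡ length Z + length Z
      twice []         = refl
      twice {_ ∷ Z} (refl ∷ p) rewrite singleton-≡ v = cong suc (trans (cong suc (twice p)) (sym (+-suc (length Z) (length Z))))
      len : length Z ≡ 3
      len = ≤-antisym (double-≤ (≤-reflexive e)) (double-≤ (≤-reflexive (sym e)))
        where e = trans (sym (twice all)) deg

-- One reduction: S, the even side of a minimum cut of size 2k, is replaced by k odd edges.
module Cut {n} {V : Label n} {E : List (Edge n)} (reg : RegularOn V E) (g : Label n) (k : ℕ) (1≤k : 1 ≤ k) (k≤3 : k ≤ 3)
  (g-value : N false g E ≡ k + k) (minimal : ∀ h → Separates (λ y → V y ≡ true) h → k + k ≤ N false h E)
  (g-sep : Separates (λ y → V y ≡ true) g) (S-even : Even# (size# (λ y → g y ∧ V y))) where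

  open RegularOn reg
  open Regularity reg

  S : Label n
  S y = g y ∧ V y

  -- A present vertex outside `S`, representing the contracted side.
  root : Fin n
  root = proj₁ (proj₂ g-sep)

  Vroot : V root ≡ true
  Vroot = proj₁ (proj₂ (proj₂ g-sep))

  Sroot : S root ≡ false
  Sroot = cong (_∧ V root) (proj₂ (proj₂ (proj₂ g-sep)))

  S⊆V : ∀ y → S y ≡ true → V y ≡ true
  S⊆V y p with g y
  ... | true = p

  xs : List (Fin n)
  xs = filter (λ y → S y 𝔹.≟ true) (allFin n)

  S⇒∈ : ∀ {y} → S y ≡ true → y ∈ xs
  S⇒∈ {y} p = ∈-filter⁺ (λ y → S y 𝔹.≟ true) (∈-allFin y) p

  ∈⇒S : ∀ {y} → y ∈ xs → S y ≡ true
  ∈⇒S {y} p = proj₂ (∈-filter⁻ (λ y → S y 𝔹.≟ true) {xs = allFin n} p)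

  ¬S⇒∉ : ∀ {y} → S y ≡ false → y ∉ xs
  ¬S⇒∉ p q = true≢false (∈⇒S q) p

  E₁ E₂ : List (Edge n)
  E₁ = proj₁ (touching S E)
  E₂ = proj₁ (proj₂ (touching S E))

  E↭ : E ↭ E₁ ++ E₂
  E↭ = proj₁ (proj₂ (proj₂ (touching S E)))

  touch : All (λ (u , w , _) → S u ∨ S w ≡ true) E₁
  touch = proj₁ (proj₂ (proj₂ (proj₂ (touching S E))))

  miss : All (λ (u , w , _) → S u ≡ false × S w ≡ false) E₂
  miss = proj₂ (proj₂ (proj₂ (proj₂ (touching S E))))

  over-parts : ∀ (φ : Edge n → ℕ) → sumOver φ E ≡ sumOver φ E₁ + sumOver φ E₂
  over-parts φ = trans (sumOver-↭ φ E↭) (sumOver-++ φ E₁ E₂)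

  all-parts : ∀ {P : Edge n → Set} → All P E → All P E₁ × All P E₂
  all-parts p = All-++⁻ E₁ (All-resp-↭ E↭ p)

  value-S : N false S E ≡ k + k
  value-S = trans (N-inside (λ y Vy → trans (cong (g y ∧_) Vy) (∧-identityʳ (g y)))) g-value

  open Reduction k root
  open Vertex k root

  outside-same : ∀ {f} → Allowed xs f → ∀ {y} → S y ≡ false → f y ≡ f root
  outside-same al p = al _ (¬S⇒∉ p)

  uncut-E₂ : ∀ {f} → (∀ {y} → S y ≡ false → f y ≡ f root) → N false f E₂ ≡ 0
  uncut-E₂ {f} same = sumOver-0 (All.map (λ { {u , w , s} (p , q) → uncut (trans (same p) (sym (same q))) }) miss)
    where
    uncut : ∀ {a b} → a ≡ b → bit ((a xor b) xor false) ≡ 0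
    uncut {a} refl rewrite xor-same a = refl

  value-S₁ : N false S E₁ ≡ k + k
  value-S₁ = begin
    N false S E₁                ≡⟨ sym (+-identityʳ _) ⟩
    N false S E₁ + 0            ≡⟨ cong (N false S E₁ +_) (sym (uncut-E₂ (λ p → trans p (sym Sroot)))) ⟩
    N false S E₁ + N false S E₂ ≡⟨ sym (over-parts _) ⟩
    N false S E                 ≡⟨ value-S ⟩
    k + k ∎
    where open ≡-Reasoning

  -- An allowed label is constant off `S`, so it cuts nothing in `E₂`, and `root` can replace absent
  -- vertices. What remains is minimality of the given cut, with the parity from `cut-even`.
  good-cut : ∀ f → Allowed xs f → Separates Everywhere f → k + k ≼ N false f E₁
  good-cut f al ((y , _ , fy) , (z , _ , fz)) =
    subst (k + k ≼_) same (≼-even {k} (minimal f (inside-V y fy , inside-V z fz)) (cut-even f))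
    where
    inside-V : ∀ y {b} → f y ≡ b → ∃[ y′ ] (V y′ ≡ true × f y′ ≡ b)
    inside-V y fy with V y in Vy
    ... | true  = y , Vy , fy
    ... | false = root , Vroot , trans (sym (outside-same al (trans (cong (g y ∧_) Vy) (∧-zeroʳ (g y))))) fy
    same : N false f E ≡ N false f E₁
    same = trans (over-parts _) (trans (cong (N false f E₁ +_) (uncut-E₂ (outside-same al))) (+-identityʳ _))

  -- `A` and `B` are the colour classes within `S`; the contracted side is coloured like `B`. As all
  -- edges are odd, a violated edge has no end in `A` (counted by p) or both ends there (counted by
  -- q). Comparing the degree sums of `A` and `B` relates p and q.
  good-label₀ : ∀ f → Allowed xs f → f root ≡ false → k ≼ N true f E₁
  good-label₀ f al froot = subst (k ≼_) (sym violated) (≼-balance (size# A) (size# B) p q k≤3 even balance)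
    where
    A B : Label n
    A y = S y ∧ f y
    B y = S y ∧ not (f y)
    f≡A : ∀ y → f y ≡ A y
    f≡A y with S y in Sy
    ... | true  = refl
    ... | false = trans (outside-same al Sy) froot
    none both : Edge n → ℕ
    none (u , w , _) = bit (not (A u) ∧ not (A w))
    both (u , w , _) = bit (A u ∧ A w)
    p q : ℕ
    p = sumOver none E₁
    q = sumOver both E₁
    violated : N true f E₁ ≡ p + q
    violated = trans (N-cong true E₁ f≡A) (trans
      (sumOver-cong (All.map (λ { {u , w , s} refl → edge (A u) (A w) }) (proj₁ (all-parts odd-signs))))
      (sumOver-+ none both E₁))
      where
      edge : ∀ a b → bit ((a xor b) xor true) ≡ bit (not a ∧ not b) + bit (a ∧ b)
      edge = toWitness {a? = ∀𝔹? λ a → ∀𝔹? λ b → bit ((a xor b) xor true) ℕ.≟ (bit (not a ∧ not b) + bit (a ∧ b))} tt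
    ∧-left : ∀ {a b} → a ∧ b ≡ true → a ≡ true
    ∧-left {true} _ = refl
    W-part : ∀ h → (∀ y → h y ≡ true → S y ≡ true) → W (bit ∘ h) E₁ ≡ 6 * size# h
    W-part h h⊆S = trans (sym (trans (over-parts _) (trans (cong (W (bit ∘ h) E₁ +_) zero₂) (+-identityʳ _))))
                         (W-size h (λ y p → S⊆V y (h⊆S y p)))
      where
      off : ∀ {y} → S y ≡ false → bit (h y) ≡ 0
      off {y} Sy = cong bit (≢true⇒≡false (λ p → true≢false (h⊆S y p) Sy))
      zero₂ : W (bit ∘ h) E₂ ≡ 0
      zero₂ = sumOver-0 (All.map (λ (p , q) → cong₂ _+_ (off p) (off q)) miss)
    even : Even# (size# A + size# B)
    even = subst Even# (trans (∑-cong n (λ y → split (S y) (f y))) (∑-+ n _ _)) S-even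
      where
      split : ∀ s a → bit s ≡ bit (s ∧ a) + bit (s ∧ not a)
      split = toWitness {a? = ∀𝔹? λ s → ∀𝔹? λ a → bit s ℕ.≟ (bit (s ∧ a) + bit (s ∧ not a))} tt
    -- The share of a single edge touching `S` in both sides of `balance`.
    edge : ∀ s s′ a b → s ∨ s′ ≡ true →
      (bit (s ∧ a) + bit (s′ ∧ b)) + (bit (not (s ∧ a) ∧ not (s′ ∧ b)) + bit (not (s ∧ a) ∧ not (s′ ∧ b)))
      ≡ (bit (s ∧ not a) + bit (s′ ∧ not b)) + bit ((s xor s′) xor false) + (bit ((s ∧ a) ∧ (s′ ∧ b)) + bit ((s ∧ a) ∧ (s′ ∧ b)))
    edge = toWitness {a? = ∀𝔹? λ s → ∀𝔹? λ s′ → ∀𝔹? λ a → ∀𝔹? λ b → ((s ∨ s′) 𝔹.≟ true) →-dec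
      (((bit (s ∧ a) + bit (s′ ∧ b)) + (bit (not (s ∧ a) ∧ not (s′ ∧ b)) + bit (not (s ∧ a) ∧ not (s′ ∧ b))))
       ℕ.≟ ((bit (s ∧ not a) + bit (s′ ∧ not b)) + bit ((s xor s′) xor false) + (bit ((s ∧ a) ∧ (s′ ∧ b)) + bit ((s ∧ a) ∧ (s′ ∧ b)))))} tt
    balance : 6 * size# A + (p + p) ≡ 6 * size# B + (k + k) + (q + q)
    balance = begin
      6 * size# A + (p + p)
        ≡⟨ cong₂ _+_ (sym (W-part A (λ _ → ∧-left))) (sym (sumOver-+ none none E₁)) ⟩
      W (bit ∘ A) E₁ + sumOver (λ e → none e + none e) E₁
        ≡⟨ sym (sumOver-+ _ _ E₁) ⟩
      sumOver (λ e@(u , w , _) → (bit (A u) + bit (A w)) + (none e + none e)) E₁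
        ≡⟨ sumOver-cong (All.map (λ { {u , w , s} t → edge (S u) (S w) (f u) (f w) t }) touch) ⟩
      sumOver (λ e@(u , w , _) → (bit (B u) + bit (B w)) + bit (crosses false S e) + (both e + both e)) E₁
        ≡⟨ trans (sumOver-+ _ _ E₁) (cong₂ _+_ (sumOver-+ _ _ E₁) (sumOver-+ both both E₁)) ⟩
      W (bit ∘ B) E₁ + N false S E₁ + (q + q)
        ≡⟨ cong (_+ (q + q)) (cong₂ _+_ (W-part B (λ _ → ∧-left)) value-S₁) ⟩
      6 * size# B + (k + k) + (q + q) ∎
      where open ≡-Reasoning

  good-label : ∀ f → Allowed xs f → k ≼ N true f E₁
  good-label f al with f root 𝔹.≟ true
  ... | no  froot = good-label₀ f al (≢true⇒≡false froot)
  ... | yes froot = subst (k ≼_) (N-not true f E₁) (good-label₀ (not ∘ f) (λ y y∉ → cong not (al y y∉)) (cong not froot))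

  good : Good Everywhere xs E₁
  good false f al sep = good-cut f al (sep refl)
  good true  f al _   = good-label f al

  reduced : ∃[ E′ ] (E₁ ⇝ E′ × Good Everywhere [] E′ × (∀ o → W o E′ ≡ W (mask-all xs o) E₁))
  reduced = split-off-all 1≤k (Unique-filter⁺ (λ y → S y 𝔹.≟ true) (allFin⁺ n)) (¬S⇒∉ Sroot) good

  abstract
    E′ : List (Edge n)
    E′ = proj₁ reduced

    E₁⇝E′ : E₁ ⇝ E′
    E₁⇝E′ = proj₁ (proj₂ reduced)

    good′ : Good Everywhere [] E′
    good′ = proj₁ (proj₂ (proj₂ reduced))

    W-E′ : ∀ o → W o E′ ≡ W (mask-all xs o) E₁
    W-E′ = proj₂ (proj₂ (proj₂ reduced))

  -- Splitting off keeps exactly the edge ends outside `S`, and `E₁` has one such end for each edge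
  -- of the cut.
  length-E′ : length E′ ≡ k
  length-E′ = ≤-antisym (double-≤ (≤-reflexive twice)) (double-≤ (≤-reflexive (sym twice)))
    where
    open ≡-Reasoning
    ones : ∀ Z → W (λ _ → 1) Z ≡ length {A = Edge n} Z + length Z
    ones []      = refl
    ones (e ∷ Z) = cong suc (trans (cong suc (ones Z)) (sym (+-suc (length Z) (length Z))))
    outside-end : ∀ y → mask-all xs (λ _ → 1) y ≡ bit (not (S y))
    outside-end y with S y in Sy
    ... | true  = mask-∈ xs _ (S⇒∈ Sy)
    ... | false = mask-∉ xs _ (¬S⇒∉ Sy)
    edge : ∀ s s′ → s ∨ s′ ≡ true → bit (not s) + bit (not s′) ≡ bit ((s xor s′) xor false)
    edge = toWitness {a? = ∀𝔹? λ s → ∀𝔹? λ s′ → ((s ∨ s′) 𝔹.≟ true) →-dec ((bit (not s) + bit (not s′)) ℕ.≟ bit ((s xor s′) xor false))} tt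
    twice : length E′ + length E′ ≡ k + k
    twice = begin
      length E′ + length E′        ≡⟨ sym (ones E′) ⟩
      W (λ _ → 1) E′               ≡⟨ W-E′ _ ⟩
      W (mask-all xs (λ _ → 1)) E₁ ≡⟨ W-cong E₁ outside-end ⟩
      W (bit ∘ not ∘ S) E₁         ≡⟨ sumOver-cong (All.map (λ { {u , w , s} t → edge (S u) (S w) t }) touch) ⟩
      N false S E₁                 ≡⟨ value-S₁ ⟩
      k + k                        ∎

  -- There are only k edges, and the constant colouring is violated by at least k of them.
  odd-E′ : All Odd-sign E′
  odd-E′ = all-odd E′ (≤-trans (≤-reflexive length-E′) (≼⇒≤ (good′ true (λ _ → false) (λ _ _ → refl) (λ ()))))

  X : Label n
  X y = not (g y) ∧ V y

  regular-X : RegularOn X (E′ ++ E₂)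
  regular-X = record
    { odd-signs = All-++⁺ odd-E′ (proj₂ (all-parts odd-signs))
    ; degrees   = λ y → trans (sumOver-++ _ E′ E₂) (trans (cong (_+ W (δ y) E₂) (W-E′ (δ y))) (degree-X y))
    ; connected = λ f sep → ≤-trans (connected-X f sep) (≤-trans (m≤n+m _ _) (≤-reflexive (sym (sumOver-++ _ E′ E₂))))
    }
    where
    in-S : ∀ y → S y ≡ true → X y ≡ false
    in-S y Sy with g y
    ... | true = refl
    off-S : ∀ y → S y ≡ false → X y ≡ V y
    off-S y Sy with g y
    ... | true  = sym Sy
    ... | false = refl
    degree-X : ∀ y → W (mask-all xs (δ y)) E₁ + W (δ y) E₂ ≡ 6 * bit (X y)
    degree-X y with S y in Sy
    ... | true = trans (cong₂ _+_ (sumOver-0 (All.universal (λ (u , w , _) → cong₂ _+_ (masked u) (masked w)) E₁))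
                                  (sumOver-0 (All.map (λ (p , q) → cong₂ _+_ (far p) (far q)) miss)))
                       (cong (λ b → 6 * bit b) (sym (in-S y Sy)))
      where
      far : ∀ {z} → S z ≡ false → δ y z ≡ 0
      far {z} Sz = cong bit (singleton-≢ {x = y} {z} (λ { refl → true≢false Sy Sz }))
      masked : ∀ z → mask-all xs (δ y) z ≡ 0
      masked z with S z in Sz
      ... | true  = mask-∈ xs (δ y) (S⇒∈ Sz)
      ... | false = trans (mask-∉ xs (δ y) (¬S⇒∉ Sz)) (far Sz)
    ... | false = trans (cong (_+ W (δ y) E₂) (W-cong E₁ unmasked))
                    (trans (sym (over-parts _)) (trans (degrees y) (cong (λ b → 6 * bit b) (sym (off-S y Sy)))))
      where
      unmasked : ∀ z → mask-all xs (δ y) z ≡ δ y z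
      unmasked z with S z in Sz
      ... | true  = trans (mask-∈ xs (δ y) (S⇒∈ Sz)) (cong bit (sym (singleton-≢ {x = y} {z} (λ { refl → true≢false Sz Sy }))))
      ... | false = mask-∉ xs (δ y) (¬S⇒∉ Sz)
    -- If f did not cut E₂, then the two parts of X would have cuts of total size 2k only.
    connected-X : ∀ f → Separates (λ y → X y ≡ true) f → 1 ≤ N false f E₂
    connected-X f ((y , Xy , fy) , (z , Xz , fz)) = ≤-trans 1≤k (double-≤ (+-cancelˡ-≤ (k + k) _ _ (begin
      (k + k) + (k + k)
        ≤⟨ +-mono-≤ (minimal h₁ ((y , in-V y Xy , cong₂ _∧_ (cong not (not-in-S y Xy)) fy) , (z , in-V z Xz , cong₂ _∧_ (cong not (not-in-S z Xz)) fz)))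
                    (minimal h₂ ((z , in-V z Xz , cong₂ _∧_ (cong not (not-in-S z Xz)) (cong not fz)) , (y , in-V y Xy , cong₂ _∧_ (cong not (not-in-S y Xy)) (cong not fy)))) ⟩
      N false h₁ E + N false h₂ E
        ≡⟨ sym (sumOver-+ _ _ E) ⟩
      sumOver both E
        ≡⟨ over-parts both ⟩
      sumOver both E₁ + sumOver both E₂
        ≤⟨ +-mono-≤ (sumOver-mono (All.map (λ { {u , w , s} t → edge₁ (S u) (S w) (f u) (f w) t }) touch))
                    (≤-reflexive (sumOver-cong (All.map (λ { {u , w , s} (p , q) → edge₂ (S u) (S w) (f u) (f w) p q }) miss))) ⟩
      N false S E₁ + sumOver (λ e → bit (crosses false f e) + bit (crosses false f e)) E₂
        ≡⟨ cong₂ _+_ value-S₁ (sumOver-+ _ _ E₂) ⟩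
      (k + k) + (N false f E₂ + N false f E₂) ∎)))
      where
      open ≤-Reasoning
      h₁ h₂ : Label n
      h₁ y = not (S y) ∧ f y
      h₂ y = not (S y) ∧ not (f y)
      both : Edge n → ℕ
      both e = bit (crosses false h₁ e) + bit (crosses false h₂ e)
      in-V : ∀ y → X y ≡ true → V y ≡ true
      in-V y p with g y
      ... | false = p
      not-in-S : ∀ y → X y ≡ true → S y ≡ false
      not-in-S y p with g y
      ... | false = refl
      -- An edge touching `S` lies in at most one of the two cuts, and only if it crosses `S`; an
      -- edge of `E₂` lies in both or in neither.
      edge₁ : ∀ s s′ a b → s ∨ s′ ≡ true →
        bit (((not s ∧ a) xor (not s′ ∧ b)) xor false) + bit (((not s ∧ not a) xor (not s′ ∧ not b)) xor false) ≤ bit ((s xor s′) xor false)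
      edge₁ = toWitness {a? = ∀𝔹? λ s → ∀𝔹? λ s′ → ∀𝔹? λ a → ∀𝔹? λ b → ((s ∨ s′) 𝔹.≟ true) →-dec
        ((bit (((not s ∧ a) xor (not s′ ∧ b)) xor false) + bit (((not s ∧ not a) xor (not s′ ∧ not b)) xor false)) ≤? bit ((s xor s′) xor false))} tt
      edge₂ : ∀ s s′ a b → s ≡ false → s′ ≡ false →
        bit (((not s ∧ a) xor (not s′ ∧ b)) xor false) + bit (((not s ∧ not a) xor (not s′ ∧ not b)) xor false)
        ≡ bit ((a xor b) xor false) + bit ((a xor b) xor false)
      edge₂ false false true  true  _ _ = refl
      edge₂ false false true  false _ _ = refl
      edge₂ false false false true  _ _ = refl
      edge₂ false false false false _ _ = refl

  reduces : E ⇝ E′ ++ E₂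
  reduces = ⇝-trans (perm E↭) (⇝-++ E₂ E₁⇝E′)

  size-S : 1 ≤ size# S
  size-S = ≤-trans (≤-reflexive (cong bit (sym (cong₂ _∧_ (proj₂ (proj₂ (proj₁ g-sep))) (proj₁ (proj₂ (proj₁ g-sep)))))))
                   (∑-member (λ y → bit (S y)) (proj₁ (proj₁ g-sep)))

separates-resp : {Q : Fin n → Set} {f g : Label n} → (∀ y → f y ≡ g y) → Separates Q f → Separates Q g
separates-resp h ((y , q , p) , (z , q′ , p′)) = (y , q , trans (sym (h y)) p) , (z , q′ , trans (sym (h z)) p′)

-- Choosing the cut, and the induction on the number of vertices.

module MinCut {n} {V : Label n} {E : List (Edge n)} (reg : RegularOn V E) (V-odd : Odd# (size# V)) where

  open RegularOn reg
  open Regularity reg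

  InV : Fin n → Set
  InV y = V y ≡ true

  inV? : ∀ y → Dec (InV y)
  inV? y = V y 𝔹.≟ true

  some-vertex : ∃ InV
  some-vertex with any? inV?
  ... | yes p = p
  ... | no none with trans (sym (trans (∑-cong n (λ y → cong bit (≢true⇒≡false (λ p → none (y , p))))) (∑-0 n))) (proj₂ V-odd)
  ... | ()

  MinimumCut : Set
  MinimumCut = ∃[ g ] ∃[ k ] (1 ≤ k × k ≤ 3 × N false g E ≡ k + k × (∀ h → Separates InV h → k + k ≤ N false h E)
                              × Separates InV g × Even# (size# (λ y → g y ∧ V y)) × Odd# (size# (λ y → not (g y) ∧ V y)))

  -- The number of vertices is odd, so exactly one side is even; if it is the wrong one, the label
  -- is complemented.
  even-side : ∀ g k → 1 ≤ k → k ≤ 3 → N false g E ≡ k + k → (∀ h → Separates InV h → k + k ≤ N false h E) →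
              Separates InV g → MinimumCut
  even-side g k 1≤k k≤3 val min sep with odd-sum {size# (λ y → g y ∧ V y)} {size# (λ y → not (g y) ∧ V y)} (subst Odd# (size#-split g V) V-odd)
  ... | inj₁ (ev , od) = g , k , 1≤k , k≤3 , val , min , sep , ev , od
  ... | inj₂ (ev , od) = not ∘ g , k , 1≤k , k≤3 , trans (N-not false g E) val , min , separates-not sep , ev ,
          subst Odd# (∑-cong n (λ y → cong (λ b → bit (b ∧ V y)) (sym (not-involutive (g y))))) od

  -- The search starts from the cut around v, so 2k is at most the degree 6; connectedness makes k
  -- positive.
  minimum-cut : ∀ {v w} → InV v → InV w → w ≢ v → MinimumCut
  minimum-cut {v} {w} Vv Vw w≢v
    with argmin separates-resp (λ f → any? (λ y → inV? y ×-dec (f y 𝔹.≟ true)) ×-dec any? (λ z → inV? z ×-dec (f z 𝔹.≟ false)))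
                (λ f → N false f E) (N-cong false E) _ (singleton v)
                ((v , Vv , singleton-≡ v) , (w , Vw , singleton-≢ w≢v)) ≤-refl
  ... | g , sep , g≤v , min with cut-even g
  ... | k , val = even-side g k (positive k (subst (1 ≤_) val (connected g sep)))
                   (double-≤ (subst (_≤ 6) val (≤-trans g≤v (≤-trans (cut-degree v) (≤-reflexive (trans (degrees v) (cong (λ b → 6 * bit b) Vv)))))))
                   val (λ h s → subst (_≤ N false h E) val (min h s)) sep
    where
    positive : ∀ k → 1 ≤ k + k → 1 ≤ k
    positive (suc k) _ = s≤s z≤n

-- Each reduction removes a nonempty even set of vertices, so the number stays odd and finally
-- reaches 1.
three-loops : ∀ m {V : Label n} {E} → size# V ≤ m → Odd# (size# V) → RegularOn V E → ∃[ v ] (E ⇝ replicate 3 (loop v true))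
three-loops zero    bound (h , odd) reg with ≤-trans (≤-reflexive (sym odd)) bound
... | ()
three-loops (suc m) {V} {E} bound odd reg with any? (λ w → inV? w ×-dec ¬? (w ≟ v))
  where
  open MinCut reg odd
  v = proj₁ some-vertex
... | no none = v , perm (↭.↭-reflexive (Regularity.one-vertex reg v only (proj₂ some-vertex)))
  where
  open MinCut reg odd
  v = proj₁ some-vertex
  only : ∀ y → V y ≡ true → y ≡ v
  only y Vy with y ≟ v
  ... | yes p = p
  ... | no  p = ⊥-elim (none (y , Vy , p))
... | yes (w , Vw , w≢v) = reduce (minimum-cut (proj₂ some-vertex) Vw w≢v)
  where
  open MinCut reg odd
  reduce : MinimumCut → ∃[ v ] (E ⇝ replicate 3 (loop v true))
  reduce (g , k , 1≤k , k≤3 , val , min , sep , even , odd′) =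
    let v , rest = three-loops m smaller odd′ regular-X in v , ⇝-trans reduces rest
    where
    open Cut reg g k 1≤k k≤3 val min sep even
    smaller : size# X ≤ m
    smaller = ≤-pred (≤-trans (+-monoˡ-≤ (size# X) size-S) (≤-trans (≤-reflexive (sym (size#-split g V))) bound))

-- Lifting to trails

odd-length : {A : Set} → List A → Bool
odd-length []       = false
odd-length (_ ∷ xs) = not (odd-length xs)

odd-length-++ : {A : Set} (xs ys : List A) → odd-length (xs ++ ys) ≡ odd-length xs xor odd-length ys
odd-length-++ []       ys = refl
odd-length-++ (x ∷ xs) ys = trans (cong not (odd-length-++ xs ys)) (not-xor (odd-length xs) (odd-length ys))
  where
  not-xor : ∀ a b → not (a xor b) ≡ not a xor b
  not-xor false b = refl
  not-xor true  b = not-involutive b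

odd-length-reverse : {A : Set} (xs : List A) → odd-length (reverse xs) ≡ odd-length xs
odd-length-reverse []       = refl
odd-length-reverse (x ∷ xs) = begin
  odd-length (reverse (x ∷ xs))          ≡⟨ cong odd-length (unfold-reverse x xs) ⟩
  odd-length (reverse xs ++ x ∷ [])      ≡⟨ odd-length-++ (reverse xs) (x ∷ []) ⟩
  odd-length (reverse xs) xor true       ≡⟨ xor-comm _ true ⟩
  not (odd-length (reverse xs))          ≡⟨ cong not (odd-length-reverse xs) ⟩
  not (odd-length xs)                    ∎
  where open ≡-Reasoning

module Trails (G : Graph) where

  joins-sym : ∀ {e u w} → Joins G e u w → Joins G e w u
  joins-sym (inj₁ p) = inj₂ p
  joins-sym (inj₂ p) = inj₁ p

  data Trail : Fin (order G) → List (Fin (size G)) → Fin (order G) → Set where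
    []  : ∀ {u} → Trail u [] u
    _∷_ : ∀ {e u w v es} → Joins G e u w → Trail w es v → Trail u (e ∷ es) v

  infixr 5 _⊙_
  _⊙_ : ∀ {u v w es fs} → Trail u es v → Trail v fs w → Trail u (es ++ fs) w
  []      ⊙ s = s
  (j ∷ t) ⊙ s = j ∷ (t ⊙ s)

  reverse-trail : ∀ {u v es} → Trail u es v → Trail v (reverse es) u
  reverse-trail []                    = []
  reverse-trail {u} {v} (_∷_ {e} {es = es} j t) =
    subst (λ fs → Trail v fs u) (sym (unfold-reverse e es)) (reverse-trail t ⊙ (joins-sym j ∷ []))

  -- Signed edges stand for edge-disjoint trails of G using the listed edges.
  data Realises : List (Edge (order G)) → List (Fin (size G)) → Set where
    []    : Realises [] []
    trail : ∀ {u w s es E fs} → Trail u es w → odd-length es ≡ s → Realises E fs → Realises ((u , w , s) ∷ E) (es ++ fs)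

  realise-↭ : ∀ {E E′ es} → E ↭ E′ → Realises E es → ∃[ fs ] (Realises E′ fs × fs ↭ es)
  realise-↭ ↭.refl r = _ , r , ↭-refl
  realise-↭ (prep _ p) (trail {es = es} t o r) with realise-↭ p r
  ... | fs , r′ , q = es ++ fs , trail t o r′ , ++⁺ˡ es q
  realise-↭ (swap _ _ p) (trail {es = es} t o (trail {es = fs} t′ o′ r)) with realise-↭ p r
  ... | gs , r′ , q = fs ++ es ++ gs , trail t′ o′ (trail t o r′) ,
        ↭-trans (shifts fs es) (++⁺ˡ es (++⁺ˡ fs q))
  realise-↭ (↭.trans p q) r with realise-↭ p r
  ... | _ , r′ , a with realise-↭ q r′
  ... | fs , r″ , b = fs , r″ , ↭-trans b a

  -- `flip` reverses a trail and `join` concatenates two at their common end, so the edges of G are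
  -- only rearranged, never lost.
  realise : ∀ {E E′ es} → E ⇝ E′ → Realises E es → ∃[ fs ] (Realises E′ fs × fs ↭ es)
  realise (perm p) r = realise-↭ p r
  realise flip (trail {es = es} {fs = fs} t o r) = reverse es ++ fs ,
    trail (reverse-trail t) (trans (odd-length-reverse es) o) r , ++⁺ʳ fs (↭-reverse es)
  realise join (trail {es = es} t o (trail {es = fs} {fs = gs} t′ o′ r)) = (es ++ fs) ++ gs ,
    trail (t ⊙ t′) (trans (odd-length-++ es fs) (cong₂ _xor_ o o′)) r , ↭.↭-reflexive (++-assoc es fs gs)
  realise (⇝-trans p q) r with realise p r
  ... | _ , r′ , a with realise q r′
  ... | fs , r″ , b = fs , r″ , ↭-trans b a

  edge : Fin (size G) → Edge (order G)
  edge e = proj₁ (ends G e) , proj₂ (ends G e) , true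

  realise-edges : ∀ es → Realises (map edge es) es
  realise-edges []       = []
  realise-edges (e ∷ es) = trail (inj₁ refl ∷ []) refl (realise-edges es)

  indicator : ∀ {m} (x v : Fin m) → [ x ≡? v ] ≡ δ v x
  indicator x v with x ≟ v
  ... | yes _ = refl
  ... | no  _ = refl

  -- A visit in the interior of the trail uses two edge ends. The added indicators complete the
  -- visits at its start and its end; for a closed trail they form an even number themselves.
  trail-degree : ∀ v {u w es} → Trail u es w → Even# (sumOver (λ e → endsAt (ends G e) v) es + ([ u ≡? v ] + [ w ≡? v ]))
  trail-degree v {u} []      = [ u ≡? v ] , refl
  trail-degree v {u} {w} (_∷_ {e} {w = x} {es = es} j t) with trail-degree v t
  ... | h , eq = [ u ≡? v ] + h , (begin
    (endsAt (ends G e) v + S) + (a + c)   ≡⟨ cong (λ m → (m + S) + (a + c)) (ends-of j) ⟩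
    ((a + b) + S) + (a + c)               ≡⟨ rearrange a b c S ⟩
    (a + a) + (S + (b + c))               ≡⟨ cong ((a + a) +_) eq ⟩
    (a + a) + (h + h)                     ≡⟨ interchange a a h h ⟩
    (a + h) + (a + h)                     ∎)
    where
    open ≡-Reasoning
    a = [ u ≡? v ]
    b = [ x ≡? v ]
    c = [ w ≡? v ]
    S = sumOver (λ e → endsAt (ends G e) v) es
    rearrange : ∀ a b c S → ((a + b) + S) + (a + c) ≡ (a + a) + (S + (b + c))
    rearrange = solve-∀
    ends-of : Joins G e u x → endsAt (ends G e) v ≡ a + b
    ends-of (inj₁ p) = cong (λ q → endsAt q v) p
    ends-of (inj₂ p) = trans (cong (λ q → endsAt q v) p) (+-comm b a)

  walk-++ : ∀ {P u v w} → Walk G P u v → Walk G P v w → Walk G P u w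
  walk-++ []             q = q
  walk-++ (step e p j r) q = step e p j (walk-++ r q)

  walk-reverse : ∀ {P u v} → Walk G P u v → Walk G P v u
  walk-reverse []             = []
  walk-reverse (step e p j r) = walk-++ (walk-reverse r) (step e p (joins-sym j) [])

  walk-to : ∀ {P u v es e a b} → Trail u es v → (∀ {f} → f ∈ es → P f) → e ∈ es → Joins G e a b → Walk G P u a
  walk-to {u = u} (_∷_ {e} {w = w} j t) P-es (here refl) j′ = at-end j j′
    where
    -- The target edge may be read in either direction, so its end a is the current vertex or lies
    -- one step further.
    at-end : ∀ {a b} → Joins G e u w → Joins G e a b → Walk G _ u a
    at-end (inj₁ p) (inj₁ q) with trans (sym p) q
    ... | refl = []
    at-end (inj₁ p) (inj₂ q) with trans (sym p) q
    ... | refl = step e (P-es (here refl)) (inj₁ p) []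
    at-end (inj₂ p) (inj₁ q) with trans (sym p) q
    ... | refl = step e (P-es (here refl)) (inj₂ p) []
    at-end (inj₂ p) (inj₂ q) with trans (sym p) q
    ... | refl = []
  walk-to (j ∷ t) P-es (there p) j′ = step _ (P-es (here refl)) j (walk-to t (λ q → P-es (there q)) p j′)

  -- Somewhere along the walk the label changes from true to false.
  walk-crosses : ∀ {P u v} (f : Label (order G)) → Walk G P u v → f u ≡ true → f v ≡ false → ∃[ e ] (crosses false f (edge e) ≡ true)
  walk-crosses f []                     fu fv = ⊥-elim (true≢false fu fv)
  walk-crosses f (step {u} {w} e _ j r) fu fv with f w in fw
  ... | true  = walk-crosses f r fw fv
  ... | false = e , cut j
    where
    cut : Joins G e u w → crosses false f (edge e) ≡ true
    cut (inj₁ p) rewrite p | fu | fw = refl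
    cut (inj₂ p) rewrite p | fu | fw = refl

∑-tabulate : ∀ {A : Set} (φ : A → ℕ) {m} (g : Fin m → A) → sumOver φ (List.tabulate g) ≡ ∑ m (φ ∘ g)
∑-tabulate φ {zero}  g = refl
∑-tabulate φ {suc m} g = cong (φ (g zero) +_) (∑-tabulate φ (g ∘ suc))

mod-even : ∀ h → (h + h) % 2 ≡ 0
mod-even zero    = refl
mod-even (suc h) rewrite +-suc h h = mod-even h

odd⇒Odd# : ∀ {a} → Odd a → Odd# a
odd⇒Odd# {a} odd with parity a
... | inj₂ o = o
... | inj₁ (h , refl) with trans (sym odd) (mod-even h)
... | ()

odd-length⇒Odd : ∀ {A : Set} (xs : List A) → odd-length xs ≡ true → Odd (length xs)
odd-length⇒Odd (_ ∷ [])     p = refl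
odd-length⇒Odd (x ∷ y ∷ xs) p = odd-length⇒Odd xs (trans (sym (not-involutive _)) p)

-- From three closed trails to a colouring of the edges.

module ThreeTrails (G : Graph) {v : Fin (order G)} {es₀ es₁ es₂ : List (Fin (size G))}
  (closed₀ : Trails.Trail G v es₀ v) (closed₁ : Trails.Trail G v es₁ v) (closed₂ : Trails.Trail G v es₂ v)
  (odd₀ : odd-length es₀ ≡ true) (odd₁ : odd-length es₁ ≡ true) (odd₂ : odd-length es₂ ≡ true)
  (partition : es₀ ++ es₁ ++ es₂ ++ [] ↭ allFin (size G)) where

  open Trails G
  open import Data.List.Membership.DecPropositional (_≟_ {size G}) using (_∈?_)

  part : Fin 3 → List (Fin (size G))
  part zero             = es₀
  part (suc zero)       = es₁
  part (suc (suc zero)) = es₂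

  closed : ∀ i → Trail v (part i) v
  closed zero             = closed₀
  closed (suc zero)       = closed₁
  closed (suc (suc zero)) = closed₂

  odd-part : ∀ i → odd-length (part i) ≡ true
  odd-part zero             = odd₀
  odd-part (suc zero)       = odd₁
  odd-part (suc (suc zero)) = odd₂

  over-parts : ∀ (φ : Fin (size G) → ℕ) → ∑ (size G) φ ≡ sumOver φ es₀ + (sumOver φ es₁ + sumOver φ es₂)
  over-parts φ = begin
    ∑ (size G) φ                        ≡⟨ sym (∑-tabulate φ (λ e → e)) ⟩
    sumOver φ (allFin (size G))         ≡⟨ sym (sumOver-↭ φ partition) ⟩
    sumOver φ (es₀ ++ es₁ ++ es₂ ++ []) ≡⟨ sumOver-++ φ es₀ _ ⟩
    sumOver φ es₀ + sumOver φ (es₁ ++ es₂ ++ [])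
      ≡⟨ cong (sumOver φ es₀ +_) (trans (sumOver-++ φ es₁ _) (cong (sumOver φ es₁ +_) (trans (sumOver-++ φ es₂ []) (+-identityʳ _)))) ⟩
    sumOver φ es₀ + (sumOver φ es₁ + sumOver φ es₂) ∎
    where open ≡-Reasoning

  -- The factor 1 gives the summand the shape that `∑-pick` expects for a constant weight.
  occurrences : Fin (size G) → List (Fin (size G)) → ℕ
  occurrences e = sumOver (λ f → 1 * δ f e)

  occurs : ∀ {e es} → e ∈ es → 1 ≤ occurrences e es
  occurs {e} e∈ = ≤-trans (≤-reflexive (cong (λ b → 1 * bit b) (sym (singleton-≡ e)))) (sumOver-member (λ f → 1 * δ f e) e∈)

  once : ∀ e → occurrences e es₀ + (occurrences e es₁ + occurrences e es₂) ≡ 1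
  once e = trans (sym (over-parts _)) (∑-pick (λ _ → 1) e)

  -- Edges in neither of the first two lists belong to `es₂` by `partition`.
  colour : Fin (size G) → Fin 3
  colour e with e ∈? es₀ | e ∈? es₁
  ... | yes _ | _     = zero
  ... | no _  | yes _ = suc zero
  ... | no _  | no _  = suc (suc zero)

  two≰one : ∀ {a b c} → 1 ≤ a → 1 ≤ b → a + b ≤ c → c ≡ 1 → ⊥
  two≰one p q r refl with ≤-trans (+-mono-≤ p q) r
  ... | s≤s ()

  colour⁺ : ∀ i {e} → e ∈ part i → colour e ≡ i
  colour⁺ i {e} e∈ with e ∈? es₀ | e ∈? es₁
  colour⁺ zero                 e∈ | yes _ | _     = refl
  colour⁺ (suc zero)       {e} e∈ | yes p | _     = ⊥-elim (two≰one (occurs p) (occurs e∈) (+-monoʳ-≤ (occurrences e es₀) (m≤m+n _ _)) (once e))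
  colour⁺ (suc (suc zero)) {e} e∈ | yes p | _     = ⊥-elim (two≰one (occurs p) (occurs e∈) (+-monoʳ-≤ (occurrences e es₀) (m≤n+m _ _)) (once e))
  colour⁺ zero                 e∈ | no p  | _     = ⊥-elim (p e∈)
  colour⁺ (suc zero)           e∈ | no _  | yes _ = refl
  colour⁺ (suc (suc zero)) {e} e∈ | no _  | yes q = ⊥-elim (two≰one (occurs q) (occurs e∈) (m≤n+m _ (occurrences e es₀)) (once e))
  colour⁺ (suc zero)           e∈ | no _  | no q  = ⊥-elim (q e∈)
  colour⁺ (suc (suc zero))     e∈ | no _  | no _  = refl

  colour⁻ : ∀ i {e} → colour e ≡ i → e ∈ part i
  colour⁻ i {e} eq with e ∈? es₀ | e ∈? es₁
  colour⁻ _ refl | yes p | _     = p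
  colour⁻ _ refl | no _  | yes q = q
  colour⁻ _ {e} refl | no p  | no q  with ∈-++⁻ es₀ (∈-resp-↭ (↭-sym partition) (∈-allFin e))
  ... | inj₁ r = ⊥-elim (p r)
  ... | inj₂ r with ∈-++⁻ es₁ r
  ... | inj₁ r′ = ⊥-elim (q r′)
  ... | inj₂ r′ with ∈-++⁻ es₂ r′
  ... | inj₁ r″ = r″

  -- The colour is constant on each of the three lists, so only the list of colour i contributes.
  sum-part : ∀ i (φ : Fin (size G) → ℕ) → ∑ (size G) (λ e → [ colour e ≡? i ] * φ e) ≡ sumOver φ (part i)
  sum-part i φ = trans (over-parts _) (trans (cong₂ _+_ (factor zero) (cong₂ _+_ (factor (suc zero)) (factor (suc (suc zero))))) (select i))
    where
    const-* : ∀ c (es : List (Fin (size G))) → sumOver (λ e → c * φ e) es ≡ c * sumOver φ es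
    const-* c []       = sym (*-zeroʳ c)
    const-* c (e ∷ es) = trans (cong (c * φ e +_) (const-* c es)) (sym (*-distribˡ-+ c (φ e) _))
    factor : ∀ j → sumOver (λ e → [ colour e ≡? i ] * φ e) (part j) ≡ [ j ≡? i ] * sumOver φ (part j)
    factor j = trans (sumOver-cong (All.tabulate (λ {e} e∈ → cong (λ c → [ c ≡? i ] * φ e) (colour⁺ j e∈)))) (const-* [ j ≡? i ] (part j))
    select : ∀ i → [ zero ≡? i ] * sumOver φ es₀ + ([ suc zero ≡? i ] * sumOver φ es₁ + [ suc (suc zero) ≡? i ] * sumOver φ es₂)
                   ≡ sumOver φ (part i)
    select zero             = trans (+-identityʳ _) (+-identityʳ _)
    select (suc zero)       = trans (+-identityʳ _) (+-identityʳ _)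
    select (suc (suc zero)) = +-identityʳ _

  eulerian : ∀ i → OddEulerianPart G colour i
  eulerian i = connected , even , odd
    where
    from-root : ∀ {u} → Incident G (InPart G colour i) u → Walk G (InPart G colour i) v u
    from-root (e , ce , w , j) = walk-to (closed i) (colour⁺ i) (colour⁻ i ce) j
    connected : ∀ u w → Incident G (InPart G colour i) u → Incident G (InPart G colour i) w → Walk G (InPart G colour i) u w
    connected u w p q = walk-++ (walk-reverse (from-root p)) (from-root q)
    even : ∀ u → Even (degreeIn G (λ e → [ colour e ≡? i ]) u)
    even u with trail-degree u (closed i)
    ... | h , eq with even-cancel [ v ≡? u ] h eq
    ... | j , eq′ = trans (cong (_% 2) (trans (sum-part i (λ e → endsAt (ends G e) u)) eq′)) (mod-even j)
    odd : Odd (∑ (size G) (λ e → [ colour e ≡? i ]))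
    odd = trans (cong (_% 2) (trans (∑-cong (size G) (λ e → sym (*-identityʳ _)))
                 (trans (sum-part i (λ _ → 1)) (sumOver-const1 (part i))))) (odd-length⇒Odd (part i) (odd-part i))

  root-incident : ∀ i → Incident G (InPart G colour i) v
  root-incident i = start (closed i) (odd-part i) (colour⁺ i)
    where
    start : ∀ {es w} → Trail v es w → odd-length es ≡ true → (∀ {e} → e ∈ es → colour e ≡ i) → Incident G (InPart G colour i) v
    start (j ∷ t) _ c = _ , c (here refl) , _ , j

  decomposition : RootedOddDecomposition 3 G
  decomposition = colour , eulerian , v , root-incident

theorem2 : (G : Graph) → Connected G → Regular 6 G → Odd (order G) →
    RootedOddDecomposition 3 G
theorem2 G connected regular odd = from-loops (three-loops (order G) (≤-reflexive all-vertices)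
    (subst Odd# (sym all-vertices) (odd⇒Odd# odd)) regular-on)
  where
  open Trails G
  E₀ : List (Edge (order G))
  E₀ = map edge (allFin (size G))
  all-vertices : size# {order G} (λ _ → true) ≡ order G
  all-vertices = ones (order G)
    where
    ones : ∀ m → ∑ m (λ _ → 1) ≡ m
    ones zero    = refl
    ones (suc m) = cong suc (ones m)
  -- Initially all vertices are present, and each edge of G is a trail of length 1, hence odd.
  regular-on : RegularOn (λ _ → true) E₀
  regular-on = record
    { odd-signs = All-map⁺ (All.universal (λ _ → refl) (allFin (size G)))
    ; degrees   = degree-at
    ; connected = cut
    }
    where
    degree-at : ∀ y → W (δ y) E₀ ≡ 6
    degree-at y = begin
      W (δ y) E₀                            ≡⟨ sumOver-map _ edge (allFin (size G)) ⟩
      sumOver deg (allFin (size G))         ≡⟨ ∑-tabulate deg (λ e → e) ⟩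
      ∑ (size G) deg                        ≡⟨ ∑-cong (size G) same ⟩
      degree G y                            ≡⟨ regular y ⟩
      6                                     ∎
      where
      open ≡-Reasoning
      deg : Fin (size G) → ℕ
      deg e = δ y (proj₁ (ends G e)) + δ y (proj₂ (ends G e))
      same : ∀ e → deg e ≡ 1 * endsAt (ends G e) y
      same e = trans (cong₂ _+_ (sym (indicator (proj₁ (ends G e)) y)) (sym (indicator (proj₂ (ends G e)) y)))
                     (sym (+-identityʳ _))
    cut : ∀ f → Separates (λ _ → true ≡ true) f → 1 ≤ N false f E₀
    cut f ((y , _ , fy) , (z , _ , fz)) with walk-crosses f (connected y z) fy fz
    ... | e , c = ≤-trans (≤-reflexive (cong bit (sym c)))
                    (sumOver-member (λ e → bit (crosses false f e)) (∈-map⁺ edge (∈-allFin e)))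
  from-loops : ∃[ v ] (E₀ ⇝ replicate 3 (loop v true)) → RootedOddDecomposition 3 G
  from-loops (v , steps) with realise steps (realise-edges (allFin (size G)))
  ... | _ , trail t₀ o₀ (trail t₁ o₁ (trail t₂ o₂ [])) , p =
    ThreeTrails.decomposition G t₀ t₁ t₂ o₀ o₁ o₂ p
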